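{- For each nonnegative integer $k$, there is a bijection $\Upsilon_k:\mathcal U_{2k+1}(312,1342)\to\mathrm{Int}(\mathrm{NC}_k)$.
   Context: The stack-sorting map $s$ on permutations (finite words of distinct positive integers): $s(\text{empty})=\text{empty}$, and if $\pi=LnR$ with $n$ the largest entry, $s(\pi)=s(L)s(R)n$. A permutation is uniquely sorted if it has exactly one preimage under $s$. A permutation avoids $\tau$ if no subsequence has the same relative order as $\tau$; $\mathcal U_n(\tau^{(1)},\tau^{(2)})$ is the set of uniquely sorted permutations of $[n]$ avoiding both patterns. A set partition of $[k]$ is noncrossing if there are no two distinct blocks $B,B'$ with $a,c\in B$, $b,d\in B'$ and $a<b<c<d$. $\mathrm{NC}_k$ is the poset of noncrossing partitions of $[k]$ ordered by refinement ($\rho\le\kappa$ iff every block of $\rho$ is contained in a block of $\kappa$), with the convention $\mathrm{NC}_0=\{\emptyset\}$. $\mathrm{Int}(P)$ is the set of pairs $(x,y)$ with $x\le y$ in $P$. -}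

module Defs where

open import Data.Nat using (ℕ; zero; suc; _<_; _⊔_; _≡ᵇ_; _+_; _*_)
open import Data.Bool using (Bool; true; false; T; if_then_else_)
open import Data.Fin as Fin using (Fin)
open import Data.List using (List; []; _∷_; _++_; [_]; length; foldr; applyUpTo)
open import Data.List.Relation.Binary.Sublist.Propositional using (_⊆_)
open import Data.List.Relation.Binary.Pointwise using (Pointwise)
open import Data.List.Relation.Binary.Permutation.Propositional using (_↭_)
open import Data.Product using (Σ; ∃; ∃-syntax; _×_; _,_; proj₁; proj₂)
open import Relation.Nullary using (¬_)
open import Relation.Binary.PropositionalEquality using (_≡_; refl; sym; trans)
open import Relation.Binary.Bundles using (Setoid)
open import Relation.Binary.Structures using (IsEquivalence)
open import Level using (0ℓ)

IsPerm : ℕ → List ℕ → Set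
IsPerm n π = π ↭ applyUpTo suc n

-- Stack-sorting map  s(LnR) = s(L) s(R) n,  n the largest entry

maxL : List ℕ → ℕ
maxL = foldr _⊔_ 0

splitAt : ℕ → List ℕ → List ℕ × List ℕ
splitAt m [] = [] , []
splitAt m (x ∷ xs) with x ≡ᵇ m
... | true  = [] , xs
... | false = let (L , R) = splitAt m xs in (x ∷ L) , R

-- recursion with fuel; fuel = length suffices since |L|,|R| < |π|
sFuel : ℕ → List ℕ → List ℕ
sFuel zero    _        = []
sFuel (suc f) []       = []
sFuel (suc f) (x ∷ xs) =
  let m = maxL (x ∷ xs)
      (L , R) = splitAt m (x ∷ xs)
  in sFuel f L ++ sFuel f R ++ [ m ]

s : List ℕ → List ℕ
s π = sFuel (length π) π

UniquelySorted : ℕ → List ℕ → Set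
UniquelySorted n π =
  Σ (List ℕ) λ σ → IsPerm n σ × s σ ≡ π × (∀ τ → IsPerm n τ → s τ ≡ π → τ ≡ σ)

-- two words of distinct entries have the same relative order
data SameOrder : List ℕ → List ℕ → Set where
  []  : SameOrder [] []
  _∷_ : ∀ {a b as bs} →
        Pointwise (λ x y → (a < x → b < y) × (b < y → a < x)) as bs →
        SameOrder as bs → SameOrder (a ∷ as) (b ∷ bs)

Contains : List ℕ → List ℕ → Set
Contains τ π = ∃[ σ ] (σ ⊆ π × SameOrder σ τ)

Avoids : List ℕ → List ℕ → Set
Avoids τ π = ¬ Contains τ π

p312 p1342 : List ℕ
p312  = 3 ∷ 1 ∷ 2 ∷ []
p1342 = 1 ∷ 3 ∷ 4 ∷ 2 ∷ []

U312-1342 : ℕ → Set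
U312-1342 n = Σ (List ℕ) λ π →
  IsPerm n π × UniquelySorted n π × Avoids p312 π × Avoids p1342 π

U312-1342-Setoid : ℕ → Setoid 0ℓ 0ℓ
U312-1342-Setoid n = record
  { Carrier = U312-1342 n
  ; _≈_ = λ x y → proj₁ x ≡ proj₁ y
  ; isEquivalence = record { refl = refl ; sym = sym ; trans = trans } }

-- Set partitions of [k] (elements Fin k), represented by their
-- "lie in the same block" relation, a Bool-valued equivalence relation.

Rel₂ : ℕ → Set
Rel₂ k = Fin k → Fin k → Bool

IsEquivRel : ∀ {k} → Rel₂ k → Set
IsEquivRel {k} R = IsEquivalence (λ x y → T (R x y))

NonCrossing : ∀ {k} → Rel₂ k → Set
NonCrossing {k} R = ∀ (a b c d : Fin k) →
  ¬ (a Fin.< b × b Fin.< c × c Fin.< d × T (R a c) × T (R b d) × ¬ T (R a b))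

NC : ℕ → Set
NC k = Σ (Rel₂ k) λ R → IsEquivRel R × NonCrossing R

_≤NC_ : ∀ {k} → NC k → NC k → Set
ρ ≤NC κ = ∀ x y → T (proj₁ ρ x y) → T (proj₁ κ x y)

IntNC : ℕ → Set
IntNC k = Σ (NC k × NC k) λ p → proj₁ p ≤NC proj₂ p

_≈NC_ : ∀ {k} → NC k → NC k → Set
ρ ≈NC κ = ∀ x y → proj₁ ρ x y ≡ proj₁ κ x y

IntNC-Setoid : ℕ → Setoid 0ℓ 0ℓ
IntNC-Setoid k = record
  { Carrier = IntNC k
  ; _≈_ = λ u v → (proj₁ (proj₁ u) ≈NC proj₁ (proj₁ v)) × (proj₂ (proj₁ u) ≈NC proj₂ (proj₁ v))
  ; isEquivalence = record
    { refl  = (λ x y → refl) , (λ x y → refl)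
    ; sym   = λ (p , q) → (λ x y → sym (p x y)) , (λ x y → sym (q x y))
    ; trans = λ (p , q) (p' , q') → (λ x y → trans (p x y) (p' x y)) , (λ x y → trans (q x y) (q' x y)) } }

{-# OPTIONS --safe #-}
module Submission where

-- Both sides are encoded by ternary trees with k nodes.
--
-- Build an interval ρ ≤ κ of noncrossing partitions by inserting points one at
-- a time in front of the others.  The new point chooses a slot: a block of κ
-- still visible from the front (or a new one) and in it a visible block of ρ
-- (or a new one).  The slots are linearly ordered, and choosing a slot discards
-- those in front of it and replaces it by three, so the choices spell the
-- preorder walk of a ternary tree.
--
-- On the other side, a word is uniquely sorted iff it is sorted and has
-- (length − 1) / 2 descents.  A word avoiding 312 is the output of a stack.  It
-- avoids 1342 iff every entry pushed after the first output leaves the stack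
-- before the next push, while the first batch may wait; so it is given by the
-- numbers of first-batch and of later entries popped after each left-to-right
-- maximum.  Sortedness amounts to a ballot condition, and these numbers spell
-- the same tree walks.

open import Defs
open import Data.Bool using (Bool; true; false; T; _∧_)
open import Data.Bool.Properties using (T?; T-∧)
open import Data.Empty using (⊥; ⊥-elim)
open import Data.Fin as Fin using (Fin; zero; suc)
import Data.Fin.Properties as Fin
open import Data.List using (List; []; _∷_; _++_; [_]; length; applyDownFrom; applyUpTo; reverse)
open import Data.Nat using (ℕ; zero; suc; _+_; _*_; _≤_; _<_; _≡ᵇ_; z≤n; s≤s; z<s; s<s; _≤′_; ≤′-refl; ≤′-step)
import Data.Nat.Properties as ℕ
open import Data.Nat.Solver using (module +-*-Solver)
open import Data.Product using (Σ; ∃; ∃-syntax; _×_; _,_; proj₁; proj₂)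
open import Data.Sum using (_⊎_; inj₁; inj₂; [_,_]′)
open import Data.Unit using (⊤; tt)
open import Function using (_∘_)
open import Function.Bundles using (Bijection; Equivalence)
open import Relation.Binary.Bundles using (Setoid)
open import Relation.Binary.Definitions using (tri<; tri≈; tri>)
open import Relation.Binary.PropositionalEquality using (_≡_; _≢_; _≗_; refl; sym; trans; cong; cong₂; subst; setoid; module ≡-Reasoning)
open import Relation.Binary.Structures using (IsEquivalence)
open import Relation.Nullary using (¬_; yes; no; does)
open import Relation.Nullary.Decidable using (decidable-stable)

-- The slots ahead of the chosen one are lost because the new point has an arc to every entry of the
-- block that it joins, and any other block with an entry under such an arc is hidden from later
-- points. What lies behind the chosen slot keeps its order, so the position of the choice in the
-- list of slots is all that has to be recorded.
--
-- A subtree still to be read is a slot: a leaf skips it, a node takes it. A node changes the height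
-- by two and a leaf by one, so only leaves change its parity, and parity can tell the two kinds of
-- pops apart. Nodes become descents; leaves at odd height, except the last, become ascents. The
-- height stays positive until the end, which is the ballot condition: no prefix has more ascents
-- than descents.
--
-- Descents govern uniqueness because the image of `L n R` is `s L`, `s R`, `n`, where only the
-- junction of the two images can create a new descent. With as many descents as possible, every
-- junction is a descent and its place is forced; with fewer, entries can be moved across some
-- maximum without changing the image.

module NoncrossingIntervals where

  open import Data.Vec using (Vec; []; _∷_; head; tail; map)
  open import Data.Vec.Relation.Unary.All using (All; []; _∷_)
  open import Data.Vec.Relation.Unary.AllPairs using (AllPairs; []; _∷_)
  open import Data.Vec.Relation.Unary.Any using (Any; here; there)

  ≡-from-T : ∀ {x y} → (T x → T y) → (T y → T x) → x ≡ y
  ≡-from-T {false} {false} f g = refl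
  ≡-from-T {false} {true}  f g = ⊥-elim (g tt)
  ≡-from-T {true}  {false} f g = ⊥-elim (f tt)
  ≡-from-T {true}  {true}  f g = refl

  -- Relations on `k` points and the insertion of a point in front.

  Row : ℕ → Set
  Row k = Fin k → Bool

  private variable
    k ℓ : ℕ
    R R′ : Rel₂ k
    a a′ b b′ : Row k

  ∅ : Row k
  ∅ _ = false

  infixr 5 _◁_
  _◁_ : Bool → Row k → Row (suc k)
  (x ◁ a) zero    = x
  (x ◁ a) (suc i) = a i

  infix 4 _∈_ _⊑_ _≺_

  _∈_ : Fin k → Row k → Set
  i ∈ a = T (a i)

  _⊑_ : Row k → Row k → Set
  a ⊑ b = ∀ i → i ∈ a → i ∈ b

  ≗⇒⊑ : a ≗ b → a ⊑ b
  ≗⇒⊑ e i = subst T (e i)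

  ≗⇒⊒ : a ≗ b → b ⊑ a
  ≗⇒⊒ e i = subst T (sym (e i))

  ⊑-antisym : a ⊑ b → b ⊑ a → a ≗ b
  ⊑-antisym f g i = ≡-from-T (f i) (g i)

  insert : Rel₂ k → Row k → Rel₂ (suc k)
  insert R a zero    zero    = true
  insert R a zero    (suc j) = a j
  insert R a (suc i) zero    = a i
  insert R a (suc i) (suc j) = R i j

  -- A row is admissible when it is empty or a block of R that a new point in
  -- front of all others may join without creating a crossing.
  record Admissible (R : Rel₂ k) (a : Row k) : Set where
    field
      closed  : ∀ {i j} → i ∈ a → T (R i j) → j ∈ a
      related : ∀ {i j} → i ∈ a → j ∈ a → T (R i j)
      visible : ∀ {i j l} → i Fin.< j → j Fin.< l → j ∈ a → T (R i l) → i ∈ a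
  open Admissible

  Admissible-resp : (∀ i j → R i j ≡ R′ i j) → a ≗ a′ → Admissible R a → Admissible R′ a′
  Admissible-resp e f A = record
    { closed  = λ {i} {j} p r → ≗⇒⊑ f j (closed A (≗⇒⊒ f i p) (subst T (sym (e i j)) r))
    ; related = λ {i} {j} p q → subst T (e i j) (related A (≗⇒⊒ f i p) (≗⇒⊒ f j q))
    ; visible = λ {i} {j} {l} u v p r →
        ≗⇒⊑ f i (visible A u v (≗⇒⊒ f j p) (subst T (sym (e i l)) r)) }

  IsNC : Rel₂ k → Set
  IsNC R = IsEquivRel R × NonCrossing R

  insert-NC : IsNC R → Admissible R a → IsNC (insert R a)
  insert-NC {k} {R} {a} (eqv , nc) A = record { refl = λ {x} → rfl x ; sym = λ {x} {y} → sy x y ; trans = λ {x} {y} {z} → tr x y z } , ncr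
    where
    module E = IsEquivalence eqv
    rfl : ∀ x → T (insert R a x x)
    rfl zero = tt
    rfl (suc x) = E.refl
    sy : ∀ x y → T (insert R a x y) → T (insert R a y x)
    sy zero zero r = r
    sy zero (suc y) r = r
    sy (suc x) zero r = r
    sy (suc x) (suc y) r = E.sym r
    tr : ∀ x y z → T (insert R a x y) → T (insert R a y z) → T (insert R a x z)
    tr zero y zero r q = tt
    tr zero zero (suc z) r q = q
    tr zero (suc y) (suc z) r q = closed A r q
    tr (suc x) zero zero r q = r
    tr (suc x) zero (suc z) r q = related A r q
    tr (suc x) (suc y) zero r q = closed A q (E.sym r)
    tr (suc x) (suc y) (suc z) r q = E.trans r q
    ncr : NonCrossing (insert R a)
    ncr zero (suc j) (suc l) (suc m) (_ , s<s u , s<s v , p , r , q) = q (visible A u v p r)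
    ncr (suc i) (suc j) (suc l) (suc m) (s<s t , s<s u , s<s v , p , r , q) = nc i j l m (t , u , v , p , r , q)

  restrict : Rel₂ (suc k) → Rel₂ k
  restrict R i j = R (suc i) (suc j)

  front : Rel₂ (suc k) → Row k
  front R j = R zero (suc j)

  restrict-NC : {R : Rel₂ (suc k)} → IsNC R → IsNC (restrict R)
  restrict-NC (eqv , nc) =
    record { refl = E.refl ; sym = E.sym ; trans = E.trans } ,
    λ i j l m (t , u , v , q) → nc (suc i) (suc j) (suc l) (suc m) (s<s t , s<s u , s<s v , q)
    where module E = IsEquivalence eqv

  front-admissible : {R : Rel₂ (suc k)} → IsNC R → Admissible (restrict R) (front R)
  front-admissible {R = R} (eqv , nc) = record
    { closed = E.trans
    ; related = λ p q → E.trans (E.sym p) q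
    ; visible = λ {i} {j} {l} u v p r → decidable-stable (T? _) λ q →
        nc zero (suc i) (suc j) (suc l) (z<s , s<s u , s<s v , p , r , q) }
    where module E = IsEquivalence eqv

  insert-restrict : {R : Rel₂ (suc k)} → IsNC R → ∀ {R₀ a} →
    (∀ i j → R₀ i j ≡ restrict R i j) → a ≗ front R → ∀ i j → insert R₀ a i j ≡ R i j
  insert-restrict (eqv , _) e f zero zero = ≡-from-T (λ _ → IsEquivalence.refl eqv) _
  insert-restrict (eqv , _) e f zero (suc j) = f j
  insert-restrict (eqv , _) e f (suc i) zero =
    trans (f i) (≡-from-T (IsEquivalence.sym eqv) (IsEquivalence.sym eqv))
  insert-restrict (eqv , _) e f (suc i) (suc j) = e i j

  -- The order of blocks and their visibility after an insertion.

  _≺_ : Row k → Row k → Set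
  a ≺ b = (∃[ i ] i ∈ b) × (∀ i j → i ∈ a → j ∈ b → i Fin.< j)

  -- The entry `m` of the middle row links the two conditions; this is why `≺` asks for a nonempty
  -- right side. The empty row, which stands for a new block, still precedes every nonempty one.
  ≺-trans : {c : Row k} → a ≺ b → b ≺ c → a ≺ c
  ≺-trans ((m , m∈b) , f) (ne , g) = ne , λ i j p q → Fin.<-trans (f i m p m∈b) (g m j m∈b q)

  ≺-respˡ : a ≗ a′ → a ≺ b → a′ ≺ b
  ≺-respˡ e (ne , f) = ne , λ i j p → f i j (≗⇒⊒ e i p)

  ≺⇒disjoint : ∀ {i} → a ≺ b → i ∈ a → i ∈ b → ⊥
  ≺⇒disjoint (_ , f) p q = Fin.<-irrefl refl (f _ _ p q)

  ≺⇒≗̸ : a ≺ b → ¬ (a ≗ b)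
  ≺⇒≗̸ l@((m , p) , f) e = ≺⇒disjoint l (≗⇒⊒ e m p) p

  ◁-≺ : ∀ {x} → (∃[ i ] i ∈ b) → (∀ i j → i ∈ a → j ∈ b → i Fin.< j) → (x ◁ a) ≺ (false ◁ b)
  ◁-≺ {b = b} {a = a} {x = x} (m , p) f = (suc m , p) , g
    where
    g : ∀ i j → i ∈ (x ◁ a) → j ∈ (false ◁ b) → i Fin.< j
    g zero (suc j) p q = z<s
    g (suc i) (suc j) p q = s<s (f i j p q)

  -- The new point has arcs to all of `a`, so a row without the new point stays visible only behind
  -- all of `a`; the converse is `extend-admissible⇒<`.
  extend-admissible : Admissible R b → (∀ i j → i ∈ a → j ∈ b → i Fin.< j) →
    Admissible (insert R a) (false ◁ b)
  extend-admissible {R = R} {b = b} {a = a} B f = record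
    { closed  = λ {i} {j} → cl i j
    ; related = λ {i} {j} → re i j
    ; visible = λ {i} {j} {l} → vi i j l }
    where
    cl : ∀ i j → i ∈ (false ◁ b) → T (insert R a i j) → j ∈ (false ◁ b)
    cl (suc i) zero p r = Fin.<-irrefl refl (f i i r p)
    cl (suc i) (suc j) p r = closed B p r
    re : ∀ i j → i ∈ (false ◁ b) → j ∈ (false ◁ b) → T (insert R a i j)
    re (suc i) (suc j) p q = related B p q
    vi : ∀ i j l → i Fin.< j → j Fin.< l → j ∈ (false ◁ b) → T (insert R a i l) → i ∈ (false ◁ b)
    vi zero (suc j) (suc l) u (s<s v) p r = Fin.<-asym v (f l j r p)
    vi (suc i) (suc j) (suc l) (s<s u) (s<s v) p r = visible B u v p r

  extend-admissible⁻ : Admissible (insert R a) (false ◁ b) → Admissible R b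
  extend-admissible⁻ B = record
    { closed = λ {i} {j} → closed B {suc i} {suc j}
    ; related = λ {i} {j} → related B {suc i} {suc j}
    ; visible = λ {i} {j} {l} u v → visible B {suc i} {suc j} {suc l} (s<s u) (s<s v) }

  extend-admissible⇒< : Admissible (insert R a) (false ◁ b) → ∀ i j → i ∈ a → j ∈ b → i Fin.< j
  extend-admissible⇒< B i j p q with Fin.<-cmp i j
  ... | tri< i<j _ _ = i<j
  ... | tri≈ _ refl _ = ⊥-elim (closed B {suc i} {zero} q p)
  ... | tri> _ _ j<i = ⊥-elim (visible B {zero} {suc j} {suc i} z<s (s<s j<i) q p)

  -- The form `b ≗ a` is what `lift-OK` can supply: the coarse row of a later slot agrees with that
  -- of the chosen one only pointwise.
  self-admissible : Admissible R a → b ≗ a → Admissible (insert R a) (true ◁ b)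
  self-admissible {R = R} {a = a} {b = b} A e = record
    { closed  = λ {i} {j} → cl i j
    ; related = λ {i} {j} → re i j
    ; visible = λ {i} {j} {l} → vi i j l }
    where
    cl : ∀ i j → i ∈ (true ◁ b) → T (insert R a i j) → j ∈ (true ◁ b)
    cl i zero p r = tt
    cl zero (suc j) p r = ≗⇒⊒ e j r
    cl (suc i) (suc j) p r = ≗⇒⊒ e j (closed A (≗⇒⊑ e i p) r)
    re : ∀ i j → i ∈ (true ◁ b) → j ∈ (true ◁ b) → T (insert R a i j)
    re zero zero p q = tt
    re zero (suc j) p q = ≗⇒⊑ e j q
    re (suc i) zero p q = ≗⇒⊑ e i p
    re (suc i) (suc j) p q = related A (≗⇒⊑ e i p) (≗⇒⊑ e j q)
    vi : ∀ i j l → i Fin.< j → j Fin.< l → j ∈ (true ◁ b) → T (insert R a i l) → i ∈ (true ◁ b)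
    vi zero _ _ _ _ _ _ = tt
    vi (suc i) (suc j) (suc l) (s<s u) (s<s v) p r = ≗⇒⊒ e i (visible A u v (≗⇒⊑ e j p) r)

  self-row : {b : Row (suc k)} → Admissible (insert R a) b → zero ∈ b → b ∘ suc ≗ a
  self-row {k = k} {R = R} {a = a} {b = b} B p =
    ⊑-antisym (λ i → related B {zero} {suc i} p) (λ i → closed B {zero} {suc i} p)

  ∅-admissible : Admissible R ∅
  ∅-admissible = record { closed = λ () ; related = λ () ; visible = λ _ _ () }

  -- The blocks of the coarser and of the finer partition that the next point joins.
  Slot : ℕ → Set
  Slot k = Row k × Row k

  infix 4 _≈_ _⋖_

  _≈_ : Slot k → Slot k → Set
  (a , b) ≈ (a′ , b′) = a ≗ a′ × b ≗ b′

  _⋖_ : Slot k → Slot k → Set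
  (a , b) ⋖ (a′ , b′) = a ≺ a′ ⊎ (a ≗ a′ × b ≺ b′)

  ⋖⇒≉ : {x y : Slot k} → x ⋖ y → ¬ (x ≈ y)
  ⋖⇒≉ (inj₁ l) (e , _) = ≺⇒≗̸ l e
  ⋖⇒≉ (inj₂ (_ , l)) (_ , e) = ≺⇒≗̸ l e

  ≈-sym : {x y : Slot k} → x ≈ y → y ≈ x
  ≈-sym (e , f) = (λ i → sym (e i)) , (λ i → sym (f i))

  ⋖-respˡ : {x x′ y : Slot k} → x ≈ x′ → x ⋖ y → x′ ⋖ y
  ⋖-respˡ (e , f) (inj₁ l) = inj₁ (≺-respˡ e l)
  ⋖-respˡ (e , f) (inj₂ (g , l)) = inj₂ ((λ i → trans (sym (e i)) (g i)) , ≺-respˡ f l)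

  AdmissibleSlot : Rel₂ k → Rel₂ k → Slot k → Set
  AdmissibleSlot κ ρ (a , b) = Admissible κ a × Admissible ρ b × b ⊑ a

  -- The list of slots after an insertion.

  meets : Row k → Row k → Bool
  meets a b = does (Fin.any? λ i → T? (a i ∧ b i))

  meets⁺ : ∀ {i} → i ∈ a → i ∈ b → meets a b ≡ true
  meets⁺ {a = a} {b = b} {i = i} p q with Fin.any? (λ i → T? (a i ∧ b i))
  ... | yes _ = refl
  ... | no n = ⊥-elim (n (i , Equivalence.from T-∧ (p , q)))

  meets⁻ : (∀ i → i ∈ a → ¬ i ∈ b) → meets a b ≡ false
  meets⁻ {a = a} {b = b} n with Fin.any? (λ i → T? (a i ∧ b i))
  ... | no _ = refl
  ... | yes (i , pq) = let p , q = Equivalence.to T-∧ pq in ⊥-elim (n i p q)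

  -- lift s x is the slot x after the new point has joined s ⋖ x: its coarse
  -- block contains the new point iff s and x share it.
  lift : Slot k → Slot k → Slot (suc k)
  lift (a , b) (a′ , b′) = (meets a a′ ◁ a′) , (false ◁ b′)

  -- The three new slots are relative to the point just inserted: a new coarse block, its coarse
  -- block with a new fine block, and its fine block.
  descend : Slot k → Vec (Slot k) ℓ → Vec (Slot (suc k)) (3 + ℓ)
  descend s@(a , b) ls = (∅ , ∅) ∷ (true ◁ a , ∅) ∷ (true ◁ a , true ◁ b) ∷ map (lift s) ls

  ∅-≺ : ∀ {i} → i ∈ b → ∅ ≺ b
  ∅-≺ {i = i} p = (i , p) , λ _ _ ()

  data Position (a b a′ b′ : Row k) : Set where
    same  : meets a a′ ≡ true → a ≗ a′ → b ≺ b′ → Position a b a′ b′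
    later : meets a a′ ≡ false → a ≺ a′ → Position a b a′ b′

  -- Two empty rows are equal without meeting, but here equal coarse rows do meet: `b ≺ b′` makes
  -- `b′` nonempty, and `b′ ⊑ a′`. Hence the Boolean `meets` separates the two cases of `⋖`.
  position : (a , b) ⋖ (a′ , b′) → b′ ⊑ a′ → Position a b a′ b′
  position {a = a} {a′ = a′} (inj₁ l) _ = later (meets⁻ {a = a} {b = a′} λ i → ≺⇒disjoint l) l
  position {a = a} {a′ = a′} (inj₂ (e , l@((i , p) , _))) t =
    same (meets⁺ {a = a} {b = a′} (≗⇒⊒ e i (t i p)) (t i p)) e l

  ≗-refl : a ≗ a
  ≗-refl _ = refl

  ◁-≗ : ∀ {x y} → x ≡ y → a ≗ b → (x ◁ a) ≗ (y ◁ b)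
  ◁-≗ e f zero = e
  ◁-≗ e f (suc i) = f i

  module _ {κ ρ : Rel₂ k} where

    private
      OK : Slot k → Set
      OK = AdmissibleSlot κ ρ

      OK′ : Slot k → Slot (suc k) → Set
      OK′ (a , b) = AdmissibleSlot (insert κ a) (insert ρ b)

    lift-OK : {s x : Slot k} → OK s → OK x → s ⋖ x → OK′ s (lift s x)
    lift-OK {a , b} {a′ , b′} (A , B , t) (A′ , B′ , t′) l with position l t′
    ... | same m e (_ , f) rewrite m =
      self-admissible A (λ i → sym (e i)) , extend-admissible B′ f , λ { (suc i) p → t′ i p }
    ... | later m (_ , f) rewrite m =
      extend-admissible A′ f , extend-admissible B′ (λ i j p q → f i j (t i p) (t′ j q)) ,
      λ { (suc i) p → t′ i p }

    descend-OK : {s : Slot k} {ls : Vec (Slot k) ℓ} → OK s → All OK ls → All (s ⋖_) ls →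
      All (OK′ s) (descend s ls)
    descend-OK {s = s@(a , b)} S@(A , B , t) os os′ =
      (∅-admissible , ∅-admissible , λ _ ()) ∷
      (self-admissible A ≗-refl , ∅-admissible , λ _ ()) ∷
      (self-admissible A ≗-refl , self-admissible B ≗-refl , λ { zero _ → tt ; (suc i) → t i }) ∷
      go os os′
      where
      go : ∀ {ℓ} {ls : Vec (Slot k) ℓ} → All OK ls → All (s ⋖_) ls → All (OK′ s) (map (lift s) ls)
      go [] [] = []
      go (o ∷ os) (l ∷ ls) = lift-OK S o l ∷ go os ls

    -- If only `x` shares the coarse block of `s`, its coarse row gains the front point, which
    -- precedes everything. If only `y` did, the coarse block of `x` would lie behind that of `s`,
    -- hence of `y`, against `x ⋖ y`.
    lift-⋖ : {s x y : Slot k} → OK x → OK y → s ⋖ x → s ⋖ y → x ⋖ y → lift s x ⋖ lift s y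
    lift-⋖ {a , b} {a₁ , b₁} {a₂ , b₂} (_ , _ , t₁) (_ , _ , t₂) l₁ l₂ l with position l₁ t₁ | position l₂ t₂ | l
    ... | same m₁ e₁ f₁ | same m₂ e₂ f₂ | inj₁ g = ⊥-elim (≺⇒≗̸ g λ i → trans (sym (e₁ i)) (e₂ i))
    ... | same m₁ e₁ f₁ | later m₂ f₂ | inj₁ (ne , g) rewrite m₁ | m₂ = inj₁ (◁-≺ ne g)
    ... | later m₁ f₁ | same m₂ e₂ f₂ | inj₁ g = ⊥-elim (≺⇒≗̸ (≺-trans f₁ g) e₂)
    ... | later m₁ f₁ | later m₂ f₂ | inj₁ (ne , g) rewrite m₁ | m₂ = inj₁ (◁-≺ ne g)
    ... | same m₁ e₁ f₁ | same m₂ e₂ f₂ | inj₂ (e , (ne , g)) = inj₂ (◁-≗ (trans m₁ (sym m₂)) e , ◁-≺ ne g)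
    ... | same m₁ e₁ f₁ | later m₂ f₂ | inj₂ (e , _) = ⊥-elim (≺⇒≗̸ f₂ λ i → trans (e₁ i) (e i))
    ... | later m₁ f₁ | same m₂ e₂ f₂ | inj₂ (e , _) = ⊥-elim (≺⇒≗̸ f₁ λ i → trans (e₂ i) (sym (e i)))
    ... | later m₁ f₁ | later m₂ f₂ | inj₂ (e , (ne , g)) = inj₂ (◁-≗ (trans m₁ (sym m₂)) e , ◁-≺ ne g)

    descend-sorted : {s : Slot k} {ls : Vec (Slot k) ℓ} → OK s → All OK ls → All (s ⋖_) ls →
      AllPairs _⋖_ ls → AllPairs _⋖_ (descend s ls)
    descend-sorted {s = s@(a , b)} S@(A , B , t) os ls ps =
      (inj₁ (∅-≺ {i = zero} tt) ∷ inj₁ (∅-≺ {i = zero} tt) ∷ go top os ls) ∷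
      (inj₂ (≗-refl , ∅-≺ {i = zero} tt) ∷ go middle os ls) ∷
      go bottom os ls ∷
      pairs os ls ps
      where
      go : {x : Slot (suc k)} → (∀ {y} → OK y → s ⋖ y → x ⋖ lift s y) →
        ∀ {ℓ} {ls : Vec (Slot k) ℓ} → All OK ls → All (s ⋖_) ls → All (x ⋖_) (map (lift s) ls)
      go f [] [] = []
      go f (o ∷ os) (l ∷ ls) = f o l ∷ go f os ls
      top : ∀ {y} → OK y → s ⋖ y → (∅ , ∅) ⋖ lift s y
      top _ (inj₁ ((i , p) , _)) = inj₁ (∅-≺ {i = suc i} p)
      top (_ , _ , t′) (inj₂ (_ , (i , p) , _)) = inj₁ (∅-≺ {i = suc i} (t′ i p))
      middle : ∀ {y} → OK y → s ⋖ y → (true ◁ a , ∅) ⋖ lift s y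
      middle (_ , _ , t′) l with position l t′
      ... | same m e ((i , p) , _) = inj₂ (◁-≗ (sym m) e , ∅-≺ {i = suc i} p)
      ... | later m (ne , f) rewrite m = inj₁ (◁-≺ ne f)
      bottom : ∀ {y} → OK y → s ⋖ y → (true ◁ a , true ◁ b) ⋖ lift s y
      bottom (_ , _ , t′) l with position l t′
      ... | same m e (ne , f) = inj₂ (◁-≗ (sym m) e , ◁-≺ ne f)
      ... | later m (ne , f) rewrite m = inj₁ (◁-≺ ne f)
      pairs : ∀ {ℓ} {ls : Vec (Slot k) ℓ} → All OK ls → All (s ⋖_) ls → AllPairs _⋖_ ls →
        AllPairs _⋖_ (map (lift s) ls)
      pairs [] [] [] = []
      pairs {ls = x ∷ _} (o ∷ os) (l ∷ ls) (p ∷ ps) = one os ls p ∷ pairs os ls ps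
        where
        one : ∀ {ℓ} {ls : Vec (Slot k) ℓ} → All OK ls → All (s ⋖_) ls → All (x ⋖_) ls →
          All (lift s x ⋖_) (map (lift s) ls)
        one [] [] [] = []
        one (o′ ∷ os) (l′ ∷ ls) (p ∷ ps) = lift-⋖ {s = s} o o′ l l′ p ∷ one os ls ps

    private
      ◁-η : (x : Row (suc k)) {c : Bool} → x zero ≡ c → x ≗ (c ◁ (x ∘ suc))
      ◁-η x e zero = e
      ◁-η x e (suc i) = refl

      ext-map : (s : Slot k) {z : Slot (suc k)} {w : Slot k} {ls : Vec (Slot k) ℓ} →
        (∀ y → w ≈ y → z ≈ lift s y) → Any (w ≈_) ls → Any (z ≈_) (map (lift s) ls)
      ext-map s f (here e) = here (f _ e)
      ext-map s f (there p) = there (ext-map s f p)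

    -- Outside the first three slots, `x` without the new point is an old slot with a nonempty row
    -- behind the chosen one, so it neither equals `s` nor precedes it. Stating the hypothesis
    -- `below` with these two negations avoids a proof that `⋖` is total.
    descend-complete : {s : Slot k} {ls : Vec (Slot k) ℓ} → OK s →
      (∀ y → OK y → ¬ y ≈ s → ¬ y ⋖ s → Any (y ≈_) ls) →
      ∀ x → OK′ s x → Any (x ≈_) (descend s ls)
    descend-complete {s = a , b} (A , B , t) below (a′ , b′) (A′ , B′ , t′)
      with a′ zero in p | b′ zero in q
    ... | false | true = ⊥-elim (subst T p (t′ zero (subst T (sym q) tt)))
    ... | true | true = there (there (here (row A′ p , row B′ q)))
      where
      row : ∀ {R : Rel₂ k} {a a′} → Admissible (insert R a) a′ → a′ zero ≡ true → a′ ≗ (true ◁ a)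
      row {a′ = a′} A′ p i = trans (◁-η a′ p i) (◁-≗ refl (self-row A′ (subst T (sym p) tt)) i)
    ... | true | false with Fin.any? (λ i → T? (b′ (suc i)))
    ... | no n = there (here (a≗ , λ i → trans (◁-η b′ q i) (empty i)))
      where
      a≗ : a′ ≗ (true ◁ a)
      a≗ i = trans (◁-η a′ p i) (◁-≗ refl (self-row A′ (subst T (sym p) tt)) i)
      empty : (false ◁ (b′ ∘ suc)) ≗ ∅
      empty zero = refl
      empty (suc i) = ≡-from-T (λ u → n (i , u)) λ ()
    ... | yes (m , r) = there (there (there (ext-map (a , b)
        (λ (a₂ , b₂) (e , f) →
          (λ i → trans (◁-η a′ p i) (◁-≗ (sym (meets⁺ {a = a} {b = a₂} (b⊑a m r) (≗⇒⊑ e m (b⊑a m r)))) (λ j → trans (a≗ j) (e j)) i)) ,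
          (λ i → trans (◁-η b′ q i) (◁-≗ refl f i)))
        (below (a , b′ ∘ suc)
          (A , extend-admissible⁻ B″ , b⊑a)
          (λ (_ , e) → Fin.<-irrefl refl (before m m (≗⇒⊑ e m r) r))
          λ { (inj₁ l) → ≺⇒≗̸ l ≗-refl
            ; (inj₂ (_ , (i , u) , f)) → Fin.<-asym (f m i r u) (before i m u r) }))))
      where
      a≗ : a′ ∘ suc ≗ a
      a≗ = self-row A′ (subst T (sym p) tt)
      B″ : Admissible (insert ρ b) (false ◁ (b′ ∘ suc))
      B″ = Admissible-resp (λ _ _ → refl) (◁-η b′ q) B′
      before = extend-admissible⇒< B″
      b⊑a : (b′ ∘ suc) ⊑ a
      b⊑a i u = ≗⇒⊑ a≗ i (t′ (suc i) u)
    descend-complete {s = a , b} (A , B , t) below (a′ , b′) (A′ , B′ , t′)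
      | false | false with Fin.any? (λ i → T? (a′ (suc i)))
    ... | no n = here ((λ i → trans (◁-η a′ p i) (empty a′ (λ i u → n (i , u)) i)) ,
                       (λ i → trans (◁-η b′ q i) (empty b′ (λ i u → n (i , t′ (suc i) u)) i)))
      where
      empty : ∀ (x : Row (suc k)) → (∀ i → ¬ T (x (suc i))) → (false ◁ (x ∘ suc)) ≗ ∅
      empty x n zero = refl
      empty x n (suc i) = ≡-from-T (n i) λ ()
    ... | yes (m , r) = there (there (there (ext-map (a , b)
        (λ (a₂ , b₂) (e , f) →
          (λ i → trans (◁-η a′ p i) (◁-≗ (sym (meets⁻ {a = a} {b = a₂} λ j u v →
            Fin.<-irrefl refl (before j j u (≗⇒⊒ e j v)))) e i)) ,
          (λ i → trans (◁-η b′ q i) (◁-≗ refl f i)))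
        (below (a′ ∘ suc , b′ ∘ suc)
          (extend-admissible⁻ A″ , extend-admissible⁻ B″ , λ i → t′ (suc i))
          (λ (e , _) → ≉ e)
          λ { (inj₁ ((i , u) , f)) → Fin.<-asym (f m i r u) (before i m u r)
            ; (inj₂ (e , _)) → ≉ e }))))
      where
      A″ : Admissible (insert κ a) (false ◁ (a′ ∘ suc))
      A″ = Admissible-resp (λ _ _ → refl) (◁-η a′ p) A′
      B″ : Admissible (insert ρ b) (false ◁ (b′ ∘ suc))
      B″ = Admissible-resp (λ _ _ → refl) (◁-η b′ q) B′
      before = extend-admissible⇒< A″
      ≉ : ¬ (a′ ∘ suc) ≗ a
      ≉ e = Fin.<-irrefl refl (before m m (≗⇒⊑ e m r) r)

  -- Codes and the intervals that they spell.

  pick : ∀ {A : Set} {m n} → m ≤′ n → Vec A n → Vec A m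
  pick ≤′-refl v = v
  -- Each `≤′-step` is one skipped entry, so the proof of the inequality is itself the choice.
  pick (≤′-step p) (_ ∷ v) = pick p v

  All-pick : ∀ {A : Set} {P : A → Set} {m n} (p : m ≤′ n) {v : Vec A n} → All P v → All P (pick p v)
  All-pick ≤′-refl ps = ps
  All-pick (≤′-step p) (_ ∷ ps) = All-pick p ps

  All-head : ∀ {A : Set} {P : A → Set} {n} {v : Vec A (suc n)} → All P v → P (head v)
  All-head (p ∷ _) = p

  AllPairs-pick : ∀ {A : Set} {P : A → A → Set} {m n} (p : m ≤′ n) {v : Vec A n} →
    AllPairs P v → AllPairs P (pick p v)
  AllPairs-pick ≤′-refl ps = ps
  AllPairs-pick (≤′-step p) (_ ∷ ps) = AllPairs-pick p ps

  -- The entry p : suc h ≤′ ℓ says that the last point skipped the ℓ − h − 1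
  -- foremost of the ℓ slots and took the next one.
  data Code : ℕ → ℕ → Set where
    []  : Code 0 1
    _∷_ : ∀ {k ℓ h} → suc h ≤′ ℓ → Code k ℓ → Code (suc k) (3 + h)

  slots : Code k ℓ → Vec (Slot k) ℓ
  coarse fine : Code k ℓ → Rel₂ k

  slots [] = (∅ , ∅) ∷ []
  slots (p ∷ c) = descend (head (pick p (slots c))) (tail (pick p (slots c)))

  coarse [] ()
  coarse (p ∷ c) = insert (coarse c) (proj₁ (head (pick p (slots c))))

  fine [] ()
  fine (p ∷ c) = insert (fine c) (proj₂ (head (pick p (slots c))))

  record Invariant {k ℓ} (κ ρ : Rel₂ k) (v : Vec (Slot k) ℓ) : Set where
    field
      coarse-NC : IsNC κ
      fine-NC   : IsNC ρ
      refines   : ∀ i j → T (ρ i j) → T (κ i j)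
      sound     : All (AdmissibleSlot κ ρ) v
      sorted    : AllPairs _⋖_ v
      complete  : ∀ x → AdmissibleSlot κ ρ x → Any (x ≈_) v
  open Invariant

  -- In a sorted list all entries skipped by `p` precede the picked one, so excluding these and the
  -- picked one leaves the tail.
  below : ∀ {h} (p : suc h ≤′ ℓ) {v : Vec (Slot k) ℓ} → AllPairs _⋖_ v →
    ∀ y → Any (y ≈_) v → ¬ y ≈ head (pick p v) → ¬ y ⋖ head (pick p v) →
    Any (y ≈_) (tail (pick p v))
  below ≤′-refl {_ ∷ _} _ y (here e) n _ = ⊥-elim (n e)
  below ≤′-refl {_ ∷ _} _ y (there q) _ _ = q
  below {h = h} (≤′-step p) {u ∷ v} (l ∷ _) y (here e) _ n =
    ⊥-elim (n (⋖-respˡ {x = u} {y = head (pick p v)} (≈-sym {x = y} {y = u} e) (All-head (All-pick p l))))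
  below (≤′-step p) {_ ∷ _} (_ ∷ s) y (there q) n m = below p s y q n m

  invariant : (c : Code k ℓ) → Invariant (coarse c) (fine c) (slots c)
  invariant [] = record
    { coarse-NC = record { refl = λ { {()} } ; sym = λ { {()} } ; trans = λ { {()} } } , λ ()
    ; fine-NC = record { refl = λ { {()} } ; sym = λ { {()} } ; trans = λ { {()} } } , λ ()
    ; refines = λ ()
    ; sound = (record { closed = λ { {()} } ; related = λ { {()} } ; visible = λ { {()} } } ,
               record { closed = λ { {()} } ; related = λ { {()} } ; visible = λ { {()} } } , λ ()) ∷ []
    ; sorted = [] ∷ []
    ; complete = λ _ _ → here ((λ ()) , λ ()) }
  invariant (_∷_ {k} {ℓ} {h} p c) = step (pick p (slots c)) refl
    where
    I = invariant c
    -- The goal mentions `pick p (slots c)`; a variable with an equation lets its shape `s ∷ ls` be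
    -- exposed.
    step : (v : Vec (Slot k) (suc h)) → pick p (slots c) ≡ v →
      Invariant (insert (coarse c) (proj₁ (head v))) (insert (fine c) (proj₂ (head v)))
        (descend (head v) (tail v))
    step (s ∷ ls) e with subst (All _) e (All-pick p (sound I)) | subst (AllPairs _) e (AllPairs-pick p (sorted I))
    ... | o@(A , B , t) ∷ os | l ∷ ps = record
      { coarse-NC = insert-NC (coarse-NC I) A
      ; fine-NC = insert-NC (fine-NC I) B
      ; refines = λ { zero zero → λ _ → tt ; zero (suc j) → t j ; (suc i) zero → t i
                    ; (suc i) (suc j) → refines I i j }
      ; sound = descend-OK o os l
      ; sorted = descend-sorted o os l ps
      ; complete = descend-complete o λ y oy n m →
          subst (λ v → Any (y ≈_) (tail v)) e
            (below p (sorted I) y (complete I y oy)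
              (subst (λ v → ¬ y ≈ head v) (sym e) n) (subst (λ v → ¬ y ⋖ head v) (sym e) m)) }

  interval : Code k ℓ → IntNC k
  interval c = ((fine c , fine-NC I) , (coarse c , coarse-NC I)) , refines I
    where I = invariant c

  pick-injective : ∀ {h h′} (p : suc h ≤′ ℓ) (p′ : suc h′ ≤′ ℓ) {v : Vec (Slot k) ℓ} → AllPairs _⋖_ v →
    head (pick p v) ≈ head (pick p′ v) → _≡_ {A = Σ ℕ λ h → suc h ≤′ ℓ} (h , p) (h′ , p′)
  pick-injective ≤′-refl ≤′-refl _ _ = refl
  pick-injective {k = k} ≤′-refl (≤′-step p′) {x ∷ v} (l ∷ _) e = ⊥-elim (⋖⇒≉ {x = x} (All-head (All-pick p′ l)) e)
  pick-injective {k = k} (≤′-step p) ≤′-refl {x ∷ v} (l ∷ _) e =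
    ⊥-elim (⋖⇒≉ {x = x} (All-head (All-pick p l)) (≈-sym {y = x} e))
  pick-injective (≤′-step p) (≤′-step p′) {_ ∷ _} (_ ∷ s) e with pick-injective p p′ s e
  ... | refl = refl

  infix 4 _≈ᴵ_
  _≈ᴵ_ : IntNC k → IntNC k → Set
  _≈ᴵ_ {k} = Setoid._≈_ (IntNC-Setoid k)

  -- Removing the front point recovers `c` and thereby its list of slots; the rows of the front
  -- point then recover the choice, as a sorted list has no repeated slot.
  interval-injective : ∀ {ℓ′} (c : Code k ℓ) (c′ : Code k ℓ′) → interval c ≈ᴵ interval c′ →
    _≡_ {A = Σ ℕ (Code k)} (ℓ , c) (ℓ′ , c′)
  interval-injective [] [] _ = refl
  interval-injective (p ∷ c) (p′ ∷ c′) (f , g)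
    with interval-injective c c′ ((λ i j → f (suc i) (suc j)) , (λ i j → g (suc i) (suc j)))
  ... | refl with pick-injective p p′ (sorted (invariant c)) ((λ i → g zero (suc i)) , (λ i → f zero (suc i)))
  ... | refl = refl

  unpick : {v : Vec (Slot k) ℓ} {x : Slot k} → Any (x ≈_) v →
    ∃[ h ] Σ (suc h ≤′ ℓ) λ p → x ≈ head (pick p v)
  unpick {v = _ ∷ _} (here e) = _ , ≤′-refl , e
  unpick {v = _ ∷ _} (there q) = let h , p , e = unpick q in h , ≤′-step p , e

  interval-surjective : (I : IntNC k) → ∃[ ℓ ] Σ (Code k ℓ) λ c → interval c ≈ᴵ I
  interval-surjective {zero} I = 1 , [] , (λ ()) , (λ ())
  interval-surjective {suc k} (((ρ , ρ-NC) , (κ , κ-NC)) , r) =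
    let ℓ , c , f , g = interval-surjective
          (((restrict ρ , restrict-NC ρ-NC) , (restrict κ , restrict-NC κ-NC)) , λ i j → r (suc i) (suc j))
        h , p , u , v = unpick (complete (invariant c) (front κ , front ρ)
          ( Admissible-resp (λ i j → sym (g i j)) ≗-refl (front-admissible κ-NC)
          , Admissible-resp (λ i j → sym (f i j)) ≗-refl (front-admissible ρ-NC)
          , λ i → r zero (suc i)))
    in 3 + h , p ∷ c ,
       insert-restrict ρ-NC f (λ i → sym (v i)) ,
       insert-restrict κ-NC g (λ i → sym (u i))

-- Ternary trees: preorder walks, codes, and the split by parity.

module Paths where

  open NoncrossingIntervals using (Code; []; _∷_)

  private variable
    h k ℓ j : ℕ

  -- Preorder walks: h subtrees with k nodes in total remain to be read.
  data Path : ℕ → ℕ → Set where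
    end  : Path 0 0
    leaf : Path h k → Path (suc h) k
    node : Path (3 + h) k → Path (suc h) (suc k)

  -- Addition that moves successors to the left, as toCode does.
  infixl 6 _⊞_
  _⊞_ : ℕ → ℕ → ℕ
  j ⊞ zero  = j
  j ⊞ suc k = suc j ⊞ k

  leaves : ∀ {m n} → m ≤′ n → Path m k → Path n k
  leaves ≤′-refl w = w
  leaves (≤′-step p) w = leaf (leaves p w)

  weaken : ∀ {m n} → suc m ≤′ n → m ≤′ n
  weaken ≤′-refl = ≤′-step ≤′-refl
  weaken (≤′-step p) = ≤′-step (weaken p)

  -- `p` counts the leaves read since the last node: of the `ℓ` slots the foremost `ℓ − h` are
  -- skipped, and the `h` subtrees still to be read are the others.
  toCode : Code j ℓ → h ≤′ ℓ → Path h k → ∃ (Code (j ⊞ k))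
  toCode c p end = _ , c
  toCode c p (leaf w) = toCode c (weaken p) w
  toCode c p (node w) = toCode (p ∷ c) ≤′-refl w

  -- `w` is the part of the walk after the choices in `c`. Each step puts the latest choice back in
  -- front of it, which changes the number of nodes; hence the sum type.
  unwind : Code j ℓ → Path ℓ k → Σ ℕ (Path 1)
  unwind [] w = _ , w
  unwind (p ∷ c) w = unwind c (leaves p (node w))

  leaves-weaken : ∀ {m n} (p : suc m ≤′ n) (w : Path m k) → leaves (weaken p) w ≡ leaves p (leaf w)
  leaves-weaken ≤′-refl w = refl
  leaves-weaken (≤′-step p) w = cong leaf (leaves-weaken p w)

  -- A code ends with the last node; the leaves after it are forced, and `leaves ℕ.z≤′n end`
  -- restores them.
  unwind-toCode : (c : Code j ℓ) (p : h ≤′ ℓ) (w : Path h k) →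
    let ℓ′ , c′ = toCode c p w in unwind c′ (leaves ℕ.z≤′n end) ≡ unwind c (leaves p w)
  unwind-toCode c p end = cong (unwind c) (l _ _)
    where
    l : ∀ {n} (p q : 0 ≤′ n) → leaves p end ≡ leaves q end
    l ≤′-refl ≤′-refl = refl
    l (≤′-step p) (≤′-step q) = cong leaf (l p q)
  unwind-toCode c p (leaf w) = trans (unwind-toCode c (weaken p) w) (cong (unwind c) (leaves-weaken p w))
  unwind-toCode c p (node w) = unwind-toCode (p ∷ c) ≤′-refl w

  toCode-injective : (w w′ : Path 1 k) → toCode [] ≤′-refl w ≡ toCode [] ≤′-refl w′ → w ≡ w′
  toCode-injective {k} w w′ e = lemma (trans (sym (unwind-toCode [] ≤′-refl w))
      (trans (cong (λ (_ , c) → unwind c (leaves ℕ.z≤′n end)) e) (unwind-toCode [] ≤′-refl w′)))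
    where
    lemma : ∀ {w w′ : Path 1 k} → _≡_ {A = Σ ℕ (Path 1)} (k , w) (k , w′) → w ≡ w′
    lemma refl = refl

  ≤′-irrelevant : ∀ {m n} (p q : m ≤′ n) → p ≡ q
  ≤′-irrelevant ≤′-refl ≤′-refl = refl
  ≤′-irrelevant ≤′-refl (≤′-step q) = ⊥-elim (ℕ.1+n≰n (ℕ.≤′⇒≤ q))
  ≤′-irrelevant (≤′-step p) ≤′-refl = ⊥-elim (ℕ.1+n≰n (ℕ.≤′⇒≤ p))
  ≤′-irrelevant (≤′-step p) (≤′-step q) = cong ≤′-step (≤′-irrelevant p q)

  toCode-leaves : ∀ {m} (c : Code j ℓ) (p : h ≤′ m) (q : m ≤′ ℓ) (r : h ≤′ ℓ) (w : Path h k) →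
    toCode c q (leaves p w) ≡ toCode c r w
  toCode-leaves c ≤′-refl q r w = cong (λ q → toCode c q w) (≤′-irrelevant q r)
  toCode-leaves c (≤′-step p) q r w = toCode-leaves c p (weaken q) r w

  -- The two codes in `toCode-unwind` have indices that are equal only propositionally, so codes are
  -- compared together with their indices.
  AnyCode : Set
  AnyCode = Σ ℕ λ k → ∃ (Code k)

  toCode-unwind : (c : Code j ℓ) (w : Path ℓ k) →
    _≡_ {A = AnyCode} (_ , toCode [] ≤′-refl (proj₂ (unwind c w))) (_ , toCode c ≤′-refl w)
  toCode-unwind [] w = refl
  toCode-unwind (p ∷ c) w = trans (toCode-unwind c (leaves p (node w)))
    (cong (_ ,_) (toCode-leaves c p ≤′-refl p (node w)))

  0⊞ : ∀ k → 0 ⊞ k ≡ k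
  0⊞ k = lemma 0 k
    where
    lemma : ∀ j k → j ⊞ k ≡ j + k
    lemma j zero = sym (ℕ.+-identityʳ j)
    lemma j (suc k) = trans (lemma (suc j) k) (sym (ℕ.+-suc j k))

  toCode-surjective : (c : ∃ (Code (0 ⊞ k))) → Σ (Path 1 k) λ w → toCode [] ≤′-refl w ≡ c
  toCode-surjective {k} (ℓ , c) = go (unwind c (leaves ℕ.z≤′n end))
    (trans (toCode-unwind c (leaves ℕ.z≤′n end)) (cong (_ ,_) (toCode-leaves c ℕ.z≤′n ≤′-refl ℕ.z≤′n end)))
    where
    go : (kw : Σ ℕ (Path 1)) →
      _≡_ {A = AnyCode} (_ , toCode [] ≤′-refl (proj₂ kw)) (0 ⊞ k , ℓ , c) →
      Σ (Path 1 k) λ w → toCode [] ≤′-refl w ≡ (ℓ , c)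
    go (k′ , w) e with trans (sym (0⊞ k′)) (trans (cong proj₁ e) (0⊞ k))
    go (k′ , w) e | refl = w , lemma e
      where
      lemma : ∀ {k} {x y : ∃ (Code k)} → _≡_ {A = AnyCode} (k , x) (k , y) → x ≡ y
      lemma refl = refl

  -- Paths read as stack words, split by the parity of the height.  At odd height
  -- (D) a node pops an entry of the first batch; at even height (E) it pops an
  -- entry pushed with the last maximum.  A leaf switches between the two, and
  -- the step up also outputs a new maximum.
  dbl : ℕ → ℕ
  dbl zero = zero
  dbl (suc h) = suc (suc (dbl h))

  data D : ℕ → ℕ → Set
  data E : ℕ → ℕ → Set

  data D where
    stop : D 0 0
    pop  : D (suc h) k → D h (suc k)
    up   : E h k → D (suc h) k

  data E where
    push : E (suc h) k → E h (suc k)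
    peak : D h k → E h k

  fromD : D h k → Path (suc (dbl h)) k
  fromE : E h k → Path (suc (suc (dbl h))) k
  fromD stop = leaf end
  fromD (pop d) = node (fromD d)
  fromD (up e) = leaf (fromE e)
  fromE (push e) = node (fromE e)
  fromE (peak d) = leaf (fromD d)

  toD : ∀ h → Path (suc (dbl h)) k → D h k
  toE : ∀ h → Path (suc (suc (dbl h))) k → E h k
  toD h (node w) = pop (toD (suc h) w)
  toD zero (leaf end) = stop
  toD (suc h) (leaf w) = up (toE h w)
  toE h (node w) = push (toE (suc h) w)
  toE h (leaf w) = peak (toD h w)

  toD-fromD : (d : D h k) → toD h (fromD d) ≡ d
  toE-fromE : (e : E h k) → toE h (fromE e) ≡ e
  toD-fromD stop = refl
  toD-fromD (pop d) = cong pop (toD-fromD d)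
  toD-fromD (up e) = cong up (toE-fromE e)
  toE-fromE (push e) = cong push (toE-fromE e)
  toE-fromE (peak d) = cong peak (toD-fromD d)

  fromD-toD : ∀ h (w : Path (suc (dbl h)) k) → fromD (toD h w) ≡ w
  fromE-toE : ∀ h (w : Path (suc (suc (dbl h))) k) → fromE (toE h w) ≡ w
  fromD-toD h (node w) = cong node (fromD-toD (suc h) w)
  fromD-toD zero (leaf end) = refl
  fromD-toD (suc h) (leaf w) = cong leaf (fromE-toE h w)
  fromE-toE h (node w) = cong node (fromE-toE (suc h) w)
  fromE-toE h (leaf w) = cong leaf (fromD-toD h w)

module Permutations where

  open Paths using (D; E; stop; pop; up; push; peak)
  open import Data.List.Membership.Propositional using (_∈_)
  import Data.List.Membership.Propositional.Properties as Mem
  import Data.List.Properties as List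
  open import Data.List.Relation.Binary.Permutation.Propositional using (_↭_; ↭-refl; ↭-sym; ↭-trans; ↭-reflexive; prep; ↭⇒↭ₛ; module PermutationReasoning)
  import Data.List.Relation.Binary.Permutation.Propositional.Properties as Perm
  import Data.List.Relation.Binary.Permutation.Setoid.Properties as SetoidPerm
  open import Data.List.Relation.Binary.Pointwise using ([]; _∷_)
  open import Data.List.Relation.Binary.Sublist.Propositional using (_⊆_; []; _∷_; _∷ʳ_; from∈; ⊆-refl; ⊆-trans)
  open import Data.List.Relation.Binary.Sublist.Propositional.Properties using (All-resp-⊆)
  open import Data.List.Relation.Unary.All as All using (All; []; _∷_)
  import Data.List.Relation.Unary.All.Properties as All
  open import Data.List.Relation.Unary.AllPairs as AllPairs using (AllPairs; []; _∷_)
  open import Data.List.Relation.Unary.Any using (here; there)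
  open import Data.List.Relation.Unary.Unique.Propositional using (Unique)
  import Data.List.Relation.Unary.Unique.Propositional.Properties as Unique

  private variable
    a b c d f h k m n p r x y z M N : ℕ
    A B C L R u v w : List ℕ

  -- The stack-sorting map

  splitAt-max : All (_< m) L → splitAt m (L ++ m ∷ R) ≡ (L , R)
  splitAt-max {m} {[]} [] with m ≡ᵇ m | ℕ.≡⇒≡ᵇ m m refl
  ... | true | _ = refl
  splitAt-max {m} {x ∷ L} {R} (x<m ∷ l) with x ≡ᵇ m | ℕ.≡ᵇ⇒≡ x m
  ... | true | f = ⊥-elim (ℕ.<-irrefl (f tt) x<m)
  ... | false | _ rewrite splitAt-max {m} {L} {R} l = refl

  maxL-++ : All (_< m) L → All (_≤ m) R → maxL (L ++ m ∷ R) ≡ m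
  maxL-++ {L = []} [] r = ℕ.m≥n⇒m⊔n≡m (bound r)
    where
    bound : ∀ {R m} → All (_≤ m) R → maxL R ≤ m
    bound [] = z≤n
    bound (p ∷ ps) = ℕ.⊔-lub p (bound ps)
  maxL-++ {L = x ∷ L} (p ∷ l) r rewrite maxL-++ {L = L} l r = ℕ.m≤n⇒m⊔n≡n (ℕ.<⇒≤ p)

  sFuel-node : ∀ f → All (_< m) L → All (_≤ m) R →
    sFuel (suc f) (L ++ m ∷ R) ≡ sFuel f L ++ sFuel f R ++ [ m ]
  sFuel-node {m} {L} {R} f l r = go (L ++ m ∷ R) refl
    where
    go : ∀ w → L ++ m ∷ R ≡ w → sFuel (suc f) w ≡ sFuel f L ++ sFuel f R ++ [ m ]
    go [] e with List.++-conicalʳ L (m ∷ R) e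
    ... | ()
    go (x ∷ w) e = cong₂ (λ n (A , B) → sFuel f A ++ sFuel f B ++ [ n ]) max
      (trans (cong (λ n → splitAt n (x ∷ w)) max) (subst (λ w → splitAt m w ≡ (L , R)) e (splitAt-max l)))
      where
      max : maxL (x ∷ w) ≡ m
      max = trans (cong maxL (sym e)) (maxL-++ l r)

  -- The cut is at the first occurrence of the maximum, where `splitAt` makes it. The strict bound
  -- on the left and the weak one on the right thus cover words with repeated entries.
  data View : List ℕ → Set where
    []   : View []
    node : ∀ {m L R} → All (_< m) L → All (_≤ m) R → View L → View R → View (L ++ m ∷ R)

  first-max : ∀ x w → ∃[ L ] ∃[ m ] ∃[ R ] (x ∷ w ≡ L ++ m ∷ R × All (_< m) L × All (_≤ m) R)
  first-max x [] = [] , x , [] , refl , [] , []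
  first-max x (y ∷ w) with first-max y w
  ... | L , m , R , e , l , r with ℕ.<-≤-connex x m
  ... | inj₁ x<m = x ∷ L , m , R , cong (x ∷_) e , x<m ∷ l , r
  ... | inj₂ m≤x = [] , x , y ∷ w , refl , [] ,
    subst (All (_≤ x)) (sym e) (All.++⁺ (All.map (λ p → ℕ.≤-trans (ℕ.<⇒≤ p) m≤x) l) (m≤x ∷ All.map (λ p → ℕ.≤-trans p m≤x) r))

  view : ∀ w → View w
  view w = go (length w) w ℕ.≤-refl
    where
    go : ∀ f w → length w ≤ f → View w
    go f [] _ = []
    go (suc f) (x ∷ w) (s≤s p) with first-max x w
    ... | L , m , R , e , l , r = subst View (sym e)
        (node l r (go f L (ℕ.≤-trans (ℕ.m≤m+n _ _) q)) (go f R (ℕ.≤-trans (ℕ.m≤n+m _ _) q)))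
      where
      q : length L + length R ≤ f
      q = ℕ.≤-trans (ℕ.≤-reflexive (ℕ.suc-injective (begin
            suc (length L + length R) ≡⟨ ℕ.+-suc (length L) (length R) ⟨
            length L + suc (length R) ≡⟨ List.length-++ L ⟨
            length (L ++ m ∷ R)       ≡⟨ cong length e ⟨
            suc (length w)            ∎))) p
        where open ≡-Reasoning

  sFuel-s : ∀ f w → length w ≤ f → sFuel f w ≡ s w
  sFuel-s f w p = go (view w) f (length w) p ℕ.≤-refl
    where
    go : ∀ {w} → View w → ∀ f g → length w ≤ f → length w ≤ g → sFuel f w ≡ sFuel g w
    go [] zero zero _ _ = refl
    go [] zero (suc g) _ _ = refl
    go [] (suc f) zero _ _ = refl
    go [] (suc f) (suc g) _ _ = refl
    go (node {m} {L} {R} l r vl vr) f g p q = go′ f g (subst (_≤ f) len p) (subst (_≤ g) len q)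
      where
      len : length (L ++ m ∷ R) ≡ suc (length L + length R)
      len = trans (List.length-++ L) (ℕ.+-suc _ _)
      go′ : ∀ f g → suc (length L + length R) ≤ f → suc (length L + length R) ≤ g →
        sFuel f (L ++ m ∷ R) ≡ sFuel g (L ++ m ∷ R)
      go′ (suc f) (suc g) (s≤s p) (s≤s q) = begin
        sFuel (suc f) (L ++ m ∷ R)    ≡⟨ sFuel-node f l r ⟩
        sFuel f L ++ sFuel f R ++ [ m ] ≡⟨ cong₂ (λ A B → A ++ B ++ [ m ])
            (go vl f g (ℕ.≤-trans (ℕ.m≤m+n _ _) p) (ℕ.≤-trans (ℕ.m≤m+n _ _) q))
            (go vr f g (ℕ.≤-trans (ℕ.m≤n+m _ _) p) (ℕ.≤-trans (ℕ.m≤n+m _ _) q)) ⟩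
        sFuel g L ++ sFuel g R ++ [ m ] ≡⟨ sFuel-node g l r ⟨
        sFuel (suc g) (L ++ m ∷ R)    ∎
        where open ≡-Reasoning

  s-node : All (_< m) L → All (_≤ m) R → s (L ++ m ∷ R) ≡ s L ++ s R ++ [ m ]
  s-node {m} {L} {R} l r = begin
    s (L ++ m ∷ R) ≡⟨ sFuel-s (suc (length (L ++ m ∷ R))) (L ++ m ∷ R) (ℕ.n≤1+n _) ⟨
    sFuel (suc (length (L ++ m ∷ R))) (L ++ m ∷ R) ≡⟨ sFuel-node _ l r ⟩
    sFuel (length (L ++ m ∷ R)) L ++ sFuel (length (L ++ m ∷ R)) R ++ [ m ]
      ≡⟨ cong₂ (λ A B → A ++ B ++ [ m ])
         (sFuel-s _ L (subst (length L ≤_) (sym (List.length-++ L)) (ℕ.m≤m+n _ _)))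
         (sFuel-s _ R (subst (length R ≤_) (sym (List.length-++ L)) (ℕ.≤-trans (ℕ.n≤1+n _) (ℕ.m≤n+m _ (length L))))) ⟩
    s L ++ s R ++ [ m ] ∎
    where open ≡-Reasoning

  s-↭ : ∀ w → s w ↭ w
  s-↭ w = go (view w)
    where
    go : ∀ {w} → View w → s w ↭ w
    go [] = ↭-refl
    go (node {m} {L} {R} l r vl vr) = ↭-trans (↭-reflexive (s-node l r))
      (Perm.++⁺ (go vl) (↭-trans (Perm.++⁺ʳ [ m ] (go vr)) (Perm.++-comm R [ m ])))

  -- The image of the map.

  data Sorted : List ℕ → Set where
    []   : Sorted []
    node : ∀ {A B n} → Sorted A → Sorted B → All (_< n) A → All (_≤ n) B → Sorted (A ++ B ++ [ n ])

  s-sorted : ∀ w → Sorted (s w)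
  s-sorted w = go (view w)
    where
    go : ∀ {w} → View w → Sorted (s w)
    go [] = []
    go (node {m} {L} {R} l r vl vr) = subst Sorted (sym (s-node l r))
      (node (go vl) (go vr) (Perm.All-resp-↭ (↭-sym (s-↭ L)) l) (Perm.All-resp-↭ (↭-sym (s-↭ R)) r))

  preimage : Sorted w → ∃[ σ ] s σ ≡ w
  preimage [] = [] , refl
  preimage (node {A} {B} {n} SA SB a b) with preimage SA | preimage SB
  ... | σ , refl | τ , refl = σ ++ n ∷ τ ,
    s-node (Perm.All-resp-↭ (s-↭ σ) a) (Perm.All-resp-↭ (s-↭ τ) b)

  tail-sorted : Sorted (x ∷ w) → Sorted w
  tail-sorted S = go S refl
    where
    -- The index `A ++ B ++ [ n ]` does not unify with a cons cell; the equation permits matching on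
    -- the derivation first and on `A` and `B` afterwards.
    go : Sorted v → v ≡ x ∷ w → Sorted w
    go (node {[]} {[]} _ _ _ _) refl = []
    go (node {[]} {_ ∷ B} SA SB a (_ ∷ b)) refl = node [] (tail-sorted SB) [] b
    go (node {_ ∷ A} SA SB (_ ∷ a) b) refl = node (tail-sorted SA) SB a b

  suffix-sorted : ∀ u → Sorted (u ++ w) → Sorted w
  suffix-sorted [] S = S
  suffix-sorted (_ ∷ u) S = suffix-sorted u (tail-sorted S)

  -- Following the children that begin with `x` leads to a node whose only entry is `x`; there `A`
  -- and `B` become its two children.
  insert-sorted : Sorted A → Sorted B → Sorted (x ∷ C) → All (_< x) A → All (_< x) B →
    Sorted (A ++ B ++ x ∷ C)
  insert-sorted {A} {B} {x} SA SB SC a b = go SC refl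
    where
    go : ∀ {v C} → Sorted v → v ≡ x ∷ C → Sorted (A ++ B ++ x ∷ C)
    go (node {[]} {[]} _ _ _ _) refl = node SA SB a (All.map ℕ.<⇒≤ b)
    go (node {[]} {_ ∷ C} {n} _ SC _ (x≤n ∷ c)) refl = subst Sorted assoc
      (node [] (go SC refl) []
        (All.++⁺ (All.map le a) (All.++⁺ (All.map le b) (x≤n ∷ c))))
      where
      le : ∀ {y} → y < x → y ≤ n
      le p = ℕ.≤-trans (ℕ.<⇒≤ p) x≤n
      assoc : (A ++ B ++ x ∷ C) ++ [ n ] ≡ A ++ B ++ x ∷ C ++ [ n ]
      assoc = trans (List.++-assoc A (B ++ x ∷ C) [ n ]) (cong (A ++_) (List.++-assoc B (x ∷ C) [ n ]))
    go (node {_ ∷ C₁} {C₂} {n} SC₁ SC₂ (x<n ∷ c₁) c₂) refl = subst Sorted assoc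
      (node (go SC₁ refl) SC₂
        (All.++⁺ (All.map (λ p → ℕ.<-trans p x<n) a) (All.++⁺ (All.map (λ p → ℕ.<-trans p x<n) b) (x<n ∷ c₁))) c₂)
      where
      assoc : (A ++ B ++ x ∷ C₁) ++ C₂ ++ [ n ] ≡ A ++ B ++ x ∷ C₁ ++ C₂ ++ [ n ]
      assoc = trans (List.++-assoc A (B ++ x ∷ C₁) (C₂ ++ [ n ])) (cong (A ++_) (List.++-assoc B (x ∷ C₁) (C₂ ++ [ n ])))

  -- Descents and uniqueness of the preimage.

  fall : ℕ → ℕ → ℕ
  fall x y with y ℕ.<? x
  ... | yes _ = 1
  ... | no _  = 0

  fall-yes : y < x → fall x y ≡ 1
  fall-yes {y} {x} p with y ℕ.<? x
  ... | yes _ = refl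
  ... | no n = ⊥-elim (n p)

  fall-no : x ≤ y → fall x y ≡ 0
  fall-no {x} {y} p with y ℕ.<? x
  ... | yes q = ⊥-elim (ℕ.<⇒≱ q p)
  ... | no _ = refl

  des : ℕ → List ℕ → ℕ
  des x [] = 0
  des x (y ∷ w) = fall x y + des y w

  lastOf : ℕ → List ℕ → ℕ
  lastOf x [] = x
  lastOf x (y ∷ w) = lastOf y w

  des-++ : ∀ x u → des x (u ++ y ∷ w) ≡ des x u + (fall (lastOf x u) y + des y w)
  des-++ x [] = refl
  des-++ x (z ∷ u) = trans (cong (fall x z +_) (des-++ z u)) (sym (ℕ.+-assoc (fall x z) _ _))

  lastOf-All : ∀ {P : ℕ → Set} x u → All P (x ∷ u) → P (lastOf x u)
  lastOf-All x [] (p ∷ []) = p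
  lastOf-All x (y ∷ u) (_ ∷ ps) = lastOf-All y u ps

  lastOf-++ : ∀ x u v → lastOf x (u ++ y ∷ v) ≡ lastOf y v
  lastOf-++ x [] v = refl
  lastOf-++ x (z ∷ u) v = lastOf-++ z u v

  lastOf-split : ∀ x u → ∃[ v ] x ∷ u ≡ v ++ [ lastOf x u ]
  lastOf-split x [] = [] , refl
  lastOf-split x (y ∷ u) with lastOf-split y u
  ... | v , e = x ∷ v , cong (x ∷_) e

  des-∷ʳ : ∀ x u → All (_≤ n) (x ∷ u) → des x (u ++ [ n ]) ≡ des x u
  des-∷ʳ {n} x u a = trans (des-++ x u) (trans
    (cong (λ d → des x u + (d + 0)) (fall-no (lastOf-All x u a))) (ℕ.+-identityʳ _))

  regroup : ∀ a f b → (a + (f + b)) + (a + (f + b)) ≡ (a + a) + ((f + f) + (b + b))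
  regroup = solve 3 (λ a f b → (a :+ (f :+ b)) :+ (a :+ (f :+ b)) := (a :+ a) :+ ((f :+ f) :+ (b :+ b))) refl
    where open +-*-Solver

  -- The entry `n` of a node adds no descent, and the junction of `A` and `B` at most one, only when
  -- both are nonempty; the tail of the joined word is then two longer than the tails of `A` and `B`
  -- together.
  des-bound : Sorted (x ∷ w) → des x w + des x w ≤ length w
  des-bound {x} {w} S = go S refl
    where
    go : ∀ {x w v} → Sorted v → v ≡ x ∷ w → des x w + des x w ≤ length w
    go (node {[]} {[]} _ _ _ _) refl = z≤n
    go (node {[]} {y ∷ B} {n} _ SB _ b) refl rewrite des-∷ʳ y B b | List.length-++ B {[ n ]} =
      ℕ.≤-trans (go SB refl) (ℕ.m≤m+n _ 1)
    go (node {x ∷ A} {[]} {n} SA _ a _) refl rewrite des-∷ʳ x A (All.map ℕ.<⇒≤ a) | List.length-++ A {[ n ]} =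
      ℕ.≤-trans (go SA refl) (ℕ.m≤m+n _ 1)
    go (node {x ∷ A} {y ∷ B} {n} SA SB _ b) refl
      rewrite des-++ {y} {B ++ [ n ]} x A | des-∷ʳ y B b | List.length-++ A {y ∷ B ++ [ n ]} | List.length-++ B {[ n ]} =
      arith (des x A) (fall (lastOf x A) y) (des y B) (fall≤1 (lastOf x A) y) (go SA refl) (go SB refl)
      where
      fall≤1 : ∀ x y → fall x y ≤ 1
      fall≤1 x y with y ℕ.<? x
      ... | yes _ = ℕ.≤-refl
      ... | no _ = z≤n
      arith : ∀ {p q} a f b → f ≤ 1 → a + a ≤ p → b + b ≤ q → (a + (f + b)) + (a + (f + b)) ≤ p + suc (q + 1)
      arith {p} {q} a f b f≤ a≤ b≤ = begin
        (a + (f + b)) + (a + (f + b)) ≡⟨ regroup a f b ⟩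
        (a + a) + ((f + f) + (b + b)) ≤⟨ ℕ.+-mono-≤ a≤ (ℕ.+-mono-≤ (ℕ.+-mono-≤ f≤ f≤) b≤) ⟩
        p + (2 + q) ≡⟨ cong (p +_) (cong suc (ℕ.+-comm 1 q)) ⟩
        p + suc (q + 1) ∎
        where open ℕ.≤-Reasoning

  -- Equality in des-bound; the other inequality holds for sorted words.
  Exact : List ℕ → Set
  Exact [] = ⊥
  Exact (x ∷ w) = length w ≤ des x w + des x w

  module _ where
    open +-*-Solver
    open ℕ.≤-Reasoning

    private
      tight : ∀ {p q a b} → a + a ≤ p → b + b ≤ q → p + q ≤ (a + a) + (b + b) → p ≤ a + a × q ≤ b + b
      tight {p} {q} {a} {b} a≤ b≤ e =
        ℕ.+-cancelʳ-≤ (b + b) p (a + a) (ℕ.≤-trans (ℕ.+-monoʳ-≤ p b≤) e) ,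
        ℕ.+-cancelˡ-≤ (a + a) q (b + b) (ℕ.≤-trans (ℕ.+-monoˡ-≤ q a≤) e)

      +2 : ∀ p q → p + suc (q + 1) ≡ 2 + (p + q)
      +2 = solve 2 (λ p q → p :+ (con 1 :+ (q :+ con 1)) := con 2 :+ (p :+ q)) refl

    exact-arith : ∀ {p q} a b x y → a + a ≤ p → b + b ≤ q →
      p + suc (q + 1) ≤ (a + (fall x y + b)) + (a + (fall x y + b)) →
      y < x × p ≤ a + a × q ≤ b + b
    exact-arith {p} {q} a b x y a≤ b≤ e with y ℕ.<? x
    ... | yes y<x = y<x , tight {a = a} {b = b} a≤ b≤ (ℕ.+-cancelˡ-≤ 2 _ _ (begin
            2 + (p + q) ≡⟨ +2 p q ⟨
            p + suc (q + 1) ≤⟨ e ⟩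
            (a + suc b) + (a + suc b) ≡⟨ solve 2 (λ a b → (a :+ (con 1 :+ b)) :+ (a :+ (con 1 :+ b)) := con 2 :+ ((a :+ a) :+ (b :+ b))) refl a b ⟩
            2 + ((a + a) + (b + b)) ∎))
    ... | no _ = ⊥-elim (ℕ.<⇒≱ {(a + b) + (a + b)} {p + suc (q + 1)} (begin-strict
            (a + b) + (a + b) ≡⟨ regroup a 0 b ⟩
            (a + a) + (b + b) ≤⟨ ℕ.+-mono-≤ a≤ b≤ ⟩
            p + q <⟨ ℕ.n<1+n _ ⟩
            suc (p + q) <⟨ ℕ.n<1+n _ ⟩
            2 + (p + q) ≡⟨ +2 p q ⟨
            p + suc (q + 1) ∎) e)

    exact-arith⁻ : ∀ {p q} a b x y → y < x → p ≤ a + a → q ≤ b + b →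
      p + suc (q + 1) ≤ (a + (fall x y + b)) + (a + (fall x y + b))
    exact-arith⁻ {p} {q} a b x y y<x a≤ b≤ rewrite fall-yes y<x = begin
      p + suc (q + 1) ≡⟨ +2 p q ⟩
      2 + (p + q) ≤⟨ ℕ.+-monoʳ-≤ 2 (ℕ.+-mono-≤ a≤ b≤) ⟩
      2 + ((a + a) + (b + b)) ≡⟨ solve 2 (λ a b → (a :+ (con 1 :+ b)) :+ (a :+ (con 1 :+ b)) := con 2 :+ ((a :+ a) :+ (b :+ b))) refl a b ⟨
      (a + suc b) + (a + suc b) ∎

  data Split (n : ℕ) : List ℕ → List ℕ → Set where
    []   : Split n [] []
    _∷ᴱ_ : ∀ {x A y B} → Exact (x ∷ A) × Exact (y ∷ B) → y < lastOf x A → Split n (x ∷ A) (y ∷ B)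

  -- If just one of `A` and `B` is empty, `n` lengthens the word without a descent to pay for it. If
  -- neither is, equality needs the descent at the junction and equality in both parts.
  exact-split : Sorted A → Sorted B → All (_≤ n) A → All (_≤ n) B → Exact (A ++ B ++ [ n ]) → Split n A B
  exact-split {[]} {[]} _ _ _ _ _ = []
  exact-split {[]} {y ∷ B} {n} _ SB _ b e rewrite des-∷ʳ y B b | List.length-++ B {[ n ]} =
    ⊥-elim (ℕ.<⇒≱ (ℕ.m<m+n (length B) (s≤s z≤n)) (ℕ.≤-trans e (des-bound SB)))
  exact-split {x ∷ A} {[]} {n} SA _ a _ e rewrite des-∷ʳ x A a | List.length-++ A {[ n ]} =
    ⊥-elim (ℕ.<⇒≱ (ℕ.m<m+n (length A) (s≤s z≤n)) (ℕ.≤-trans e (des-bound SA)))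
  exact-split {x ∷ A} {y ∷ B} {n} SA SB a b e
    rewrite des-++ {y} {B ++ [ n ]} x A | des-∷ʳ y B b | List.length-++ A {y ∷ B ++ [ n ]} | List.length-++ B {[ n ]} =
    let p , q , r = exact-arith (des x A) (des y B) (lastOf x A) y (des-bound SA) (des-bound SB) e in (q , r) ∷ᴱ p

  exact-join : All (_≤ n) (y ∷ B) → Exact (x ∷ A) → Exact (y ∷ B) → y < lastOf x A → Exact (x ∷ A ++ y ∷ B ++ [ n ])
  exact-join {n} {y} {B} {x} {A} b p q r
    rewrite des-++ {y} {B ++ [ n ]} x A | des-∷ʳ y B b | List.length-++ A {y ∷ B ++ [ n ]} | List.length-++ B {[ n ]} =
    exact-arith⁻ (des x A) (des y B) (lastOf x A) y r p q

  -- A suffix of a sorted word is sorted, so it cannot have the extra descent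
  -- that moving the split point to the right would create.
  no-shift : ∀ c C → Sorted ((c ∷ C) ++ y ∷ w) → y < lastOf c C → Exact (y ∷ w) → ⊥
  no-shift {y} {w} c C S r e with lastOf-split c C
  ... | v , eq with des-bound (suffix-sorted v (subst Sorted (trans (cong (_++ y ∷ w) eq) (List.++-assoc v [ lastOf c C ] (y ∷ w))) S))
  ... | b rewrite fall-yes r = ℕ.<⇒≱ (s≤s (subst (length w <_) (sym (ℕ.+-suc _ _)) (s≤s e))) b

  ++-compare : ∀ (A A′ : List ℕ) {B B′} → A ++ B ≡ A′ ++ B′ →
    (A ≡ A′ × B ≡ B′) ⊎ (∃[ c ] ∃[ C ] (A′ ≡ A ++ c ∷ C × B ≡ c ∷ C ++ B′)) ⊎
    (∃[ c ] ∃[ C ] (A ≡ A′ ++ c ∷ C × B′ ≡ c ∷ C ++ B))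
  ++-compare [] [] e = inj₁ (refl , e)
  ++-compare [] (c ∷ C) e = inj₂ (inj₁ (c , C , refl , e))
  ++-compare (c ∷ C) [] e = inj₂ (inj₂ (c , C , refl , sym e))
  ++-compare (x ∷ A) (x′ ∷ A′) e with List.∷-injective e
  ... | refl , e′ with ++-compare A A′ e′
  ... | inj₁ (p , q) = inj₁ (cong (x ∷_) p , q)
  ... | inj₂ (inj₁ (c , C , p , q)) = inj₂ (inj₁ (c , C , cong (x ∷_) p , q))
  ... | inj₂ (inj₂ (c , C , p , q)) = inj₂ (inj₂ (c , C , cong (x ∷_) p , q))

  -- If the cuts differ, the longer right part is a sorted word that contains the shorter, exact one
  -- right after a descent; `no-shift` excludes this.
  split-unique : ∀ {A B A′ B′ n} → Sorted B → Sorted B′ → Split n A B → Split n A′ B′ →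
    A ++ B ≡ A′ ++ B′ → A ≡ A′ × B ≡ B′
  split-unique SB SB′ [] [] _ = refl , refl
  split-unique SB SB′ [] (_ ∷ᴱ _) ()
  split-unique SB SB′ (_ ∷ᴱ _) [] ()
  split-unique SB SB′ (_∷ᴱ_ {x} {A} {y} {B} (_ , q) p) (_∷ᴱ_ {x′} {A′} {y′} {B′} (_ , q′) p′) e
    with ++-compare (x ∷ A) (x′ ∷ A′) e
  ... | inj₁ r = r
  ... | inj₂ (inj₁ (c , C , refl , f)) =
    ⊥-elim (no-shift c C (subst Sorted f SB) (subst (y′ <_) (lastOf-++ x A C) p′) q′)
  ... | inj₂ (inj₂ (c , C , refl , f)) =
    ⊥-elim (no-shift c C (subst Sorted f SB′) (subst (y <_) (lastOf-++ x′ A′ C) p) q)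

  s-All : ∀ {P : ℕ → Set} w → All P w → All P (s w)
  s-All w = Perm.All-resp-↭ (↭-sym (s-↭ w))

  s-empty : ∀ w → s w ≡ [] → w ≡ []
  s-empty w e = Perm.↭-empty-inv (↭-sym (subst (_↭ w) e (s-↭ w)))

  -- The last entry of the image is the maximum of any preimage, exactness leaves one place to cut
  -- the rest into two images, and it passes to both of them.
  exact⇒unique-preimage : ∀ σ τ → s τ ≡ s σ → Exact (s σ) → τ ≡ σ
  exact⇒unique-preimage σ τ = go (view σ) (view τ)
    where
    go : ∀ {σ τ} → View σ → View τ → s τ ≡ s σ → Exact (s σ) → τ ≡ σ
    go [] _ _ ()
    go (node {m} {L} {R} l r _ _) [] e _ = sym (s-empty (L ++ m ∷ R) (sym e))
    go (node {m} {L} {R} l r vL vR) (node {m′} {L′} {R′} l′ r′ vL′ vR′) e x =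
      join (List.∷ʳ-injective (s L′ ++ s R′) (s L ++ s R) (begin
        (s L′ ++ s R′) ++ [ m′ ] ≡⟨ List.++-assoc (s L′) (s R′) _ ⟩
        s L′ ++ s R′ ++ [ m′ ]   ≡⟨ s-node l′ r′ ⟨
        s (L′ ++ m′ ∷ R′)        ≡⟨ e ⟩
        s (L ++ m ∷ R)           ≡⟨ s-node l r ⟩
        s L ++ s R ++ [ m ]      ≡⟨ List.++-assoc (s L) (s R) _ ⟨
        (s L ++ s R) ++ [ m ]    ∎))
      where
      open ≡-Reasoning
      split = exact-split (s-sorted L) (s-sorted R) (s-All L (All.map ℕ.<⇒≤ l)) (s-All R r)
        (subst Exact (s-node l r) x)
      split′ = exact-split (s-sorted L′) (s-sorted R′) (s-All L′ (All.map ℕ.<⇒≤ l′)) (s-All R′ r′)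
        (subst Exact (trans (sym e) (s-node l′ r′)) x)
      rec : ∀ {A B} → Split m A B → A ≡ s L → B ≡ s R → s L′ ≡ s L → s R′ ≡ s R → L′ ≡ L × R′ ≡ R
      rec [] p q e₁ e₂ =
        trans (s-empty L′ (trans e₁ (sym p))) (sym (s-empty L (sym p))) ,
        trans (s-empty R′ (trans e₂ (sym q))) (sym (s-empty R (sym q)))
      rec ((a , b) ∷ᴱ _) p q e₁ e₂ = go vL vL′ e₁ (subst Exact p a) , go vR vR′ e₂ (subst Exact q b)
      join : s L′ ++ s R′ ≡ s L ++ s R × m′ ≡ m → L′ ++ m′ ∷ R′ ≡ L ++ m ∷ R
      join (f , refl) =
        let e₁ , e₂ = split-unique (s-sorted R′) (s-sorted R) split′ split f
            p , q = rec split refl refl e₁ e₂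
        in cong₂ (λ L R → L ++ m ∷ R) p q

  lastOf-max : Sorted (x ∷ w) → All (_≤ lastOf x w) (x ∷ w)
  lastOf-max S = go S refl
    where
    go : ∀ {v} → Sorted v → v ≡ x ∷ w → All (_≤ lastOf x w) (x ∷ w)
    go (node {[]} {[]} _ _ _ _) refl = ℕ.≤-refl ∷ []
    go (node {[]} {y ∷ B} {n} _ _ _ b) refl rewrite lastOf-++ {n} y B [] = All.++⁺ b (ℕ.≤-refl ∷ [])
    go (node {x ∷ A} {B} {n} _ _ a b) refl rewrite trans (cong (lastOf x) (sym (List.++-assoc A B [ n ]))) (lastOf-++ {n} x (A ++ B) []) =
      All.++⁺ (All.map ℕ.<⇒≤ a) (All.++⁺ b (ℕ.≤-refl ∷ []))

  Unique-resp : u ↭ v → Unique u → Unique v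
  Unique-resp p = SetoidPerm.Unique-resp-↭ (setoid ℕ) (↭⇒↭ₛ p)

  Unique-++ : ∀ u → Unique (u ++ y ∷ v) → All (_≢ y) u
  Unique-++ [] _ = []
  Unique-++ (x ∷ u) (p ∷ ps) = All.head (All.++⁻ʳ u p) ∷ Unique-++ u ps

  Unique-++ˡ : ∀ u → Unique (u ++ v) → Unique u
  Unique-++ˡ [] _ = []
  Unique-++ˡ (x ∷ u) (p ∷ ps) = All.++⁻ˡ u p ∷ Unique-++ˡ u ps

  Unique-++ʳ : ∀ u → Unique (u ++ v) → Unique v
  Unique-++ʳ [] ps = ps
  Unique-++ʳ (x ∷ u) (_ ∷ ps) = Unique-++ʳ u ps

  -- Every defect yields a second preimage: with one side of `m` empty, the other side can change
  -- places with `m`; without a descent at the junction, a preimage of `s L ++ s R` can be put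
  -- before `m`. The two sides inherit uniqueness.
  unique-preimage⇒exact : ∀ σ → Unique σ → σ ≢ [] → (∀ τ → s τ ≡ s σ → τ ≡ σ) → Exact (s σ)
  unique-preimage⇒exact σ = go (view σ)
    where
    go : ∀ {σ} → View σ → Unique σ → σ ≢ [] → (∀ τ → s τ ≡ s σ → τ ≡ σ) → Exact (s σ)
    go [] _ n _ = n refl
    go (node {m} {L} {R} l r vL vR) U _ u = subst Exact (sym (s-node l r))
        (cases (s L) (s R) refl refl)
      where
      U-R : Unique (m ∷ R)
      U-R = Unique-++ʳ L U
      R<m : All (_< m) R
      R<m = go′ r (AllPairs.head U-R)
        where
        go′ : ∀ {R} → All (_≤ m) R → All (m ≢_) R → All (_< m) R
        go′ [] [] = []
        go′ (p ∷ ps) (q ∷ qs) = ℕ.≤∧≢⇒< p (λ e → q (sym e)) ∷ go′ ps qs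
      bounds : ∀ {P : ℕ → Set} {A τ} → s τ ≡ s A → All P A → All P τ
      bounds {A = A} {τ} e p = Perm.All-resp-↭ (↭-trans (↭-sym (s-↭ A)) (↭-trans (↭-reflexive (sym e)) (s-↭ τ))) p
      uL : ∀ τ → s τ ≡ s L → τ ≡ L
      uL τ e = List.++-cancelʳ (m ∷ R) τ L (u (τ ++ m ∷ R)
        (trans (s-node {L = τ} (bounds e l) r) (trans (cong (_++ s R ++ [ m ]) e) (sym (s-node l r)))))
      uR : ∀ τ → s τ ≡ s R → τ ≡ R
      uR τ e = List.∷-injectiveʳ (List.++-cancelˡ L (m ∷ τ) (m ∷ R) (u (L ++ m ∷ τ)
        (trans (s-node l (bounds e r)) (trans (cong (λ w → s L ++ w ++ [ m ]) e) (sym (s-node l r))))))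
      no-end : ∀ τ → s τ ≡ s L ++ s R → R ≡ []
      no-end τ e = sym (cong proj₂ (trans (sym (splitAt-max {R = []} <m)) (trans (cong (splitAt m) (u (τ ++ [ m ])
          (trans (s-node <m []) (trans (cong (_++ [ m ]) e) (trans (List.++-assoc (s L) (s R) [ m ]) (sym (s-node l r)))))))
          (splitAt-max l))))
        where
        <m : All (_< m) τ
        <m = Perm.All-resp-↭ (s-↭ τ) (subst (All _) (sym e) (All.++⁺ (s-All L l) (s-All R R<m)))
      no-start : s R ≡ [] → L ≡ []
      no-start e = sym (cong proj₁ (trans (sym (splitAt-max {L = []} {R = L} [])) (trans (cong (splitAt m) (u (m ∷ L)
          (trans (s-node {L = []} [] (All.map ℕ.<⇒≤ l)) (trans (cong (λ w → s L ++ w ++ [ m ]) (sym e)) (sym (s-node l r))))))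
          (splitAt-max l))))
      ne : ∀ {A x w} → s A ≡ x ∷ w → A ≢ []
      ne () refl
      cases : ∀ A B → s L ≡ A → s R ≡ B → Exact (A ++ B ++ [ m ])
      cases [] [] _ _ = z≤n
      cases [] (y ∷ B) e f with trans (cong s (sym (no-end R (cong (_++ s R) (sym e))))) f
      ... | ()
      cases (x ∷ A) [] e f with trans (cong s (sym (no-start f))) e
      ... | ()
      cases (x ∷ A) (y ∷ B) e f with y ℕ.<? lastOf x A
      ... | yes p = exact-join {x = x} {A = A} (subst (All _) f (s-All R r))
          (subst Exact e (go vL (Unique-++ˡ L U) (ne e) uL))
          (subst Exact f (go vR (AllPairs.tail U-R) (ne f) uR)) p
      -- Distinctness makes `y` exceed the last entry of `s L`, its maximum. So `s L` can become a
      -- child of `y`, and `s L ++ s R` is an image too.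
      ... | no n = ⊥-elim (ne f (no-end (proj₁ pre) (proj₂ pre)))
        where
        SA : Sorted (x ∷ A)
        SA = subst Sorted e (s-sorted L)
        distinct : All (_≢ y) (x ∷ A)
        distinct = Unique-++ (x ∷ A) (Unique-resp
          (↭-trans (Perm.++⁺ (↭-sym (s-↭ L)) (↭-trans (Perm.++-comm [ m ] R) (Perm.++⁺ʳ [ m ] (↭-sym (s-↭ R))))) (↭-reflexive (cong₂ _++_ e (cong (_++ [ m ]) f)))) U)
        last<y : lastOf x A < y
        last<y = ℕ.≤∧≢⇒< (ℕ.≮⇒≥ n) (lastOf-All x A distinct)
        pre : ∃[ τ ] s τ ≡ s L ++ s R
        pre = preimage (subst Sorted (cong₂ _++_ (sym e) (sym f)) (insert-sorted [] SA (subst Sorted f (s-sorted R)) []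
          (All.map (λ p → ℕ.≤-<-trans p last<y) (lastOf-max SA))))

  -- Words generated by a stack

  -- wordD M d: the entries 1, …, popsD d wait on the stack, and M is the largest
  -- entry pushed so far.  wordE M N e: the entries M + 1, …, M + pushes e wait
  -- above them, and N is the largest entry pushed so far.
  popsD : D h k → ℕ
  popsE : E h k → ℕ
  popsD stop = 0
  popsD (pop d) = suc (popsD d)
  popsD (up e) = popsE e
  popsE (push e) = popsE e
  popsE (peak d) = popsD d

  pushes : E h k → ℕ
  pushes (push e) = suc (pushes e)
  pushes (peak _) = 0

  wordD : ℕ → D h k → List ℕ
  wordE : ℕ → ℕ → E h k → List ℕ
  wordD M stop = []
  wordD M (pop d) = suc (popsD d) ∷ wordD M d
  wordD M (up e) = suc (M + pushes e) ∷ wordE M (suc (M + pushes e)) e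
  wordE M N (push e) = suc (M + pushes e) ∷ wordE M N e
  wordE M N (peak d) = wordD N d

  toWord : D 0 k → List ℕ
  toWord d = suc (popsD d) ∷ wordD (suc (popsD d)) d

  -- Each `pop` or `push` outputs an entry and raises `h`, each `up` outputs one and lowers it, and
  -- `stop` needs `h = 0`. So `k` entries of the first kind, the descents of `wordD-des`, are
  -- matched by `h + k` of the second.
  length-wordD : ∀ M (d : D h k) → length (wordD M d) ≡ h + (k + k)
  length-wordE : ∀ M N (e : E h k) → length (wordE M N e) ≡ h + (k + k)
  length-wordD M stop = refl
  length-wordD {h} {suc k} M (pop d) rewrite length-wordD M d | ℕ.+-suc k k | ℕ.+-suc h (suc (k + k)) | ℕ.+-suc h (k + k) = refl
  length-wordD M (up e) = cong suc (length-wordE _ _ e)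
  length-wordE {h} {suc k} M N (push e) rewrite length-wordE M N e | ℕ.+-suc k k | ℕ.+-suc h (suc (k + k)) | ℕ.+-suc h (k + k) = refl
  length-wordE M N (peak d) = length-wordD N d

  down : ℕ → ℕ → List ℕ
  down M = applyDownFrom (λ i → suc (M + i))

  down-+ : ∀ M c e → down M (c + e) ≡ down (M + e) c ++ down M e
  down-+ M zero e = refl
  down-+ M (suc c) e = cong₂ _∷_ (cong suc (trans (cong (M +_) (ℕ.+-comm c e)) (sym (ℕ.+-assoc M e c)))) (down-+ M c e)

  down-bounds : ∀ M c → All (λ z → M < z × z ≤ M + c) (down M c)
  down-bounds M zero = []
  down-bounds M (suc c) rewrite ℕ.+-suc M c = (s≤s (ℕ.m≤m+n M c) , ℕ.≤-refl) ∷
    All.map (λ (p , q) → p , ℕ.m≤n⇒m≤1+n q) (down-bounds M c)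

  countD : D h k → ℕ
  countE : E h k → ℕ
  countD stop = 0
  countD (pop d) = countD d
  countD (up e) = countE e + suc (pushes e)
  countE (push e) = countE e
  countE (peak d) = countD d

  wordD-↭ : ∀ M (d : D h k) → wordD M d ↭ down 0 (popsD d) ++ down M (countD d)
  wordE-↭ : ∀ M N (e : E h k) →
    wordE M N e ↭ down M (pushes e) ++ down 0 (popsE e) ++ down N (countE e)
  wordD-↭ M stop = ↭-refl
  wordD-↭ M (pop d) = prep _ (wordD-↭ M d)
  wordD-↭ M (up e) = begin
    top ∷ wordE M top e  ↭⟨ prep top (wordE-↭ M top e) ⟩
    (top ∷ down M (pushes e)) ++ (down 0 (popsE e) ++ down top (countE e))
      ↭⟨ Perm.++-comm (top ∷ down M (pushes e)) _ ⟩
    (down 0 (popsE e) ++ down top (countE e)) ++ down M (suc (pushes e))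
      ≡⟨ List.++-assoc (down 0 (popsE e)) _ _ ⟩
    down 0 (popsE e) ++ down top (countE e) ++ down M (suc (pushes e))
      ≡⟨ cong (λ t → down 0 (popsE e) ++ down t (countE e) ++ down M (suc (pushes e))) (sym (ℕ.+-suc M (pushes e))) ⟩
    down 0 (popsE e) ++ down (M + suc (pushes e)) (countE e) ++ down M (suc (pushes e))
      ≡⟨ cong (down 0 (popsE e) ++_) (sym (down-+ M (countE e) (suc (pushes e)))) ⟩
    down 0 (popsE e) ++ down M (countE e + suc (pushes e)) ∎
    where
    open PermutationReasoning
    top = suc (M + pushes e)
  wordE-↭ M N (push e) = prep _ (wordE-↭ M N e)
  wordE-↭ M N (peak d) = wordD-↭ N d

  wordD-bounds : ∀ M (d : D h k) → All (λ z → z ≤ popsD d ⊎ M < z) (wordD M d)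
  wordD-bounds M d = Perm.All-resp-↭ (↭-sym (wordD-↭ M d)) (All.++⁺
    (All.map (λ (_ , q) → inj₁ q) (down-bounds 0 (popsD d)))
    (All.map (λ (p , _) → inj₂ p) (down-bounds M (countD d))))

  wordE-bounds : ∀ M N (e : E h k) →
    All (λ z → (M < z × z ≤ M + pushes e) ⊎ z ≤ popsE e ⊎ N < z) (wordE M N e)
  wordE-bounds M N e = Perm.All-resp-↭ (↭-sym (wordE-↭ M N e)) (All.++⁺
    (All.map inj₁ (down-bounds M (pushes e))) (All.++⁺
    (All.map (λ (_ , q) → inj₂ (inj₁ q)) (down-bounds 0 (popsE e)))
    (All.map (λ (p , _) → inj₂ (inj₂ p)) (down-bounds N (countE e)))))

  toWord-perm : (d : D 0 k) → IsPerm (suc (2 * k)) (toWord d)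
  toWord-perm {k} d = begin
    suc q ∷ wordD (suc q) d  ↭⟨ prep (suc q) (wordD-↭ (suc q) d) ⟩
    down 0 (suc q) ++ down (suc q) l ↭⟨ Perm.++-comm (down 0 (suc q)) _ ⟩
    down (suc q) l ++ down 0 (suc q) ≡⟨ down-+ 0 l (suc q) ⟨
    down 0 (l + suc q)               ≡⟨ cong (down 0) size ⟩
    down 0 (suc (2 * k))             ≡⟨ List.reverse-applyUpTo suc (suc (2 * k)) ⟨
    reverse (applyUpTo suc (suc (2 * k))) ↭⟨ Perm.↭-reverse _ ⟩
    applyUpTo suc (suc (2 * k)) ∎
    where
    open PermutationReasoning
    q = popsD d
    l = countD d
    size : l + suc q ≡ suc (2 * k)
    size = trans (ℕ.+-suc l q) (cong suc (trans (ℕ.+-comm l q) (trans (sym (trans (Perm.↭-length (wordD-↭ (suc q) d))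
      (trans (List.length-++ (down 0 q)) (cong₂ _+_ (List.length-applyDownFrom _ q) (List.length-applyDownFrom _ l)))))
      (trans (length-wordD (suc q) d) (cong (k +_) (sym (ℕ.+-identityʳ k)))))))

  wordD-des : ∀ M (d : D h k) → popsD d < p → popsD d ≤ M → k ≤ des p (wordD M d)
  wordE-des : ∀ M N (e : E h k) → M + pushes e < p → popsE e ≤ M → M ≤ N → k ≤ des p (wordE M N e)
  wordD-des M stop _ _ = z≤n
  wordD-des M (pop d) a b rewrite fall-yes a = s≤s (wordD-des M d ℕ.≤-refl (ℕ.<⇒≤ b))
  wordD-des M (up e) a b = ℕ.≤-trans (wordE-des M _ e ℕ.≤-refl b (ℕ.m≤n⇒m≤1+n (ℕ.m≤m+n _ _))) (ℕ.m≤n+m _ _)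
  wordE-des M N (push e) a b c rewrite ℕ.+-suc M (pushes e) | fall-yes a = s≤s (wordE-des M N e ℕ.≤-refl b c)
  wordE-des M N (peak d) a b c = wordD-des N d (ℕ.≤-<-trans b (ℕ.≤-<-trans (ℕ.m≤m+n M 0) a)) (ℕ.≤-trans b c)

  -- A word cut into h + 1 sorted blocks.  The first entry of each later block
  -- exceeds m and everything before it, so it can close an extra descent.
  data Blocks (m : ℕ) : ℕ → List ℕ → Set where
    one  : Sorted (x ∷ B) → Blocks m 0 (x ∷ B)
    cons : Sorted (x ∷ B) → All (_< z) (x ∷ B) → m < z → Blocks m h (z ∷ u) → Blocks m (suc h) (x ∷ B ++ z ∷ u)

  Blocks-weaken : m ≤ n → Blocks n h u → Blocks m h u
  Blocks-weaken q (one S) = one S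
  Blocks-weaken q (cons S a r b) = cons S a (ℕ.≤-<-trans q r) (Blocks-weaken q b)

  Blocks-ascent : p < x → m < x → Blocks m h (x ∷ u) → Blocks m (suc h) (p ∷ x ∷ u)
  Blocks-ascent q r b = cons (node [] [] [] []) (q ∷ []) r b

  -- The head `z` of the second block exceeds `p` and the whole first block, so it can take these
  -- two as its children.
  Blocks-descent : p ≤ m → Blocks m (suc h) u → Blocks m h (p ∷ u)
  Blocks-descent {p} {m} q (cons {x} {B} {z} S a r b) = go b
    where
    merge : ∀ {C} → Sorted (z ∷ C) → Sorted (p ∷ x ∷ B ++ z ∷ C)
    merge S′ = insert-sorted (node [] [] [] []) S S′ (ℕ.≤-<-trans q r ∷ []) a
    go : ∀ {h u} → Blocks m h (z ∷ u) → Blocks m h (p ∷ x ∷ B ++ z ∷ u)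
    go (one S′) = one (merge S′)
    go (cons {B = C} {z = z′} {u = u} S′ (z<z′ ∷ c) r′ b′) =
      subst (Blocks m _) (cong (λ w → p ∷ x ∷ w) (List.++-assoc B (z ∷ C) (z′ ∷ u)))
        (cons (merge S′) (ℕ.≤-<-trans q r′ ∷ All.++⁺ (All.map (λ t → ℕ.<-trans t z<z′) a) (z<z′ ∷ c)) r′ b′)

  -- Going back from the end of the word, an ascent opens a block and a descent spends one. The
  -- ballot condition keeps one available, and at `h = 0` a single sorted word remains.
  wordD-blocks : ∀ M (d : D h k) → popsD d ≤ M → p ≤ M → Blocks M h (p ∷ wordD M d)
  wordE-blocks : ∀ M N (e : E h k) → popsE e ≤ M → M + pushes e ≤ N → p ≤ N → Blocks N h (p ∷ wordE M N e)
  wordD-blocks M stop a b = one (node [] [] [] [])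
  wordD-blocks M (pop d) a b = Blocks-descent b (wordD-blocks M d (ℕ.<⇒≤ a) a)
  wordD-blocks M (up e) a b = Blocks-ascent (s≤s (ℕ.≤-trans b (ℕ.m≤m+n M _))) (s≤s (ℕ.m≤m+n M _))
    (Blocks-weaken (ℕ.m≤n⇒m≤1+n (ℕ.m≤m+n M _)) (wordE-blocks M _ e a (ℕ.n≤1+n _) ℕ.≤-refl))
  wordE-blocks M N (push e) a b c = Blocks-descent c (wordE-blocks M N e a (ℕ.<⇒≤ b′) b′)
    where b′ = subst (_≤ N) (ℕ.+-suc M _) b
  wordE-blocks M N (peak d) a b c = wordD-blocks N d (ℕ.≤-trans a (ℕ.≤-trans (ℕ.m≤m+n M 0) b)) c

  toWord-sorted : (d : D 0 k) → Sorted (toWord d)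
  toWord-sorted d with wordD-blocks (suc (popsD d)) d (ℕ.n≤1+n _) ℕ.≤-refl
  ... | one S = S

  toWord-exact : (d : D 0 k) → Exact (toWord d)
  toWord-exact d = ℕ.≤-trans (ℕ.≤-reflexive (length-wordD _ d)) (ℕ.+-mono-≤ bound bound)
    where bound = wordD-des _ d ℕ.≤-refl (ℕ.n≤1+n _)

  toWord-uniquelySorted : (d : D 0 k) → UniquelySorted (suc (2 * k)) (toWord d)
  toWord-uniquelySorted d with preimage (toWord-sorted d)
  ... | σ , e = σ , ↭-trans (↭-sym (s-↭ σ)) (↭-trans (↭-reflexive e) (toWord-perm d)) , e ,
    λ τ _ f → exact⇒unique-preimage σ τ (trans f (sym e)) (subst Exact (sym e) (toWord-exact d))

  -- Pattern avoidance

  No12Below : ℕ → List ℕ → Set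
  No12Below x = AllPairs λ b c → c ≤ x → c < b

  No231Above : ℕ → List ℕ → Set
  No231Above x [] = ⊤
  No231Above x (b ∷ u) = AllPairs (λ c d → b < c → d ≤ b → d ≤ x) u × No231Above x u

  No312 : List ℕ → Set
  No312 [] = ⊤
  No312 (x ∷ u) = No12Below x u × No312 u

  No1342 : List ℕ → Set
  No1342 [] = ⊤
  No1342 (x ∷ u) = No231Above x u × No1342 u

  module _ {R : ℕ → ℕ → Set} where
    allPairs : (∀ c d → R c d) → ∀ u → AllPairs R u
    allPairs f [] = []
    allPairs f (x ∷ u) = All.universal (f x) u ∷ allPairs f u

    allPairs-second : All (λ d → ∀ c → R c d) u → AllPairs R u
    allPairs-second [] = []
    allPairs-second (p ∷ ps) = All.map (λ f → f _) ps ∷ allPairs-second ps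

    AllPairs-⊆ : b ∷ c ∷ [] ⊆ u → AllPairs R u → R b c
    AllPairs-⊆ (_ ∷ʳ p) (_ ∷ ps) = AllPairs-⊆ p ps
    AllPairs-⊆ (refl ∷ p) (q ∷ _) = All.head (All-resp-⊆ p q)

  No312⇒avoids : No312 u → Avoids p312 u
  No312⇒avoids v (_ , p , ((_ ∷ (f , _) ∷ []) ∷ ((_ , g) ∷ []) ∷ [] ∷ [])) =
    ℕ.<-asym (g (s<s z<s)) (go v p (ℕ.≮⇒≥ λ q → ℕ.<-asym (f q) (s<s (s<s z<s))))
    where
    go : No312 u → a ∷ b ∷ c ∷ [] ⊆ u → c ≤ a → c < b
    go (_ , v) (_ ∷ʳ p) = go v p
    go (q , _) (refl ∷ p) = AllPairs-⊆ p q

  No1342⇒avoids : No1342 u → Avoids p1342 u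
  No1342⇒avoids v (_ , p , ((_ ∷ _ ∷ (_ , f) ∷ []) ∷ ((_ , g) ∷ (h , _) ∷ []) ∷ (_ ∷ []) ∷ [] ∷ [])) =
    ℕ.<⇒≱ (f (s<s z<s)) (go v p (g (s<s (s<s (s<s z<s)))) (ℕ.≮⇒≥ λ q → ℕ.<-asym (h q) (s<s (s<s z<s))))
    where
    go′ : No231Above a u → b ∷ c ∷ d ∷ [] ⊆ u → b < c → d ≤ b → d ≤ a
    go′ {u = _ ∷ _} (_ , v) (_ ∷ʳ p) = go′ v p
    go′ {u = _ ∷ _} (q , _) (refl ∷ p) = AllPairs-⊆ p q
    go : No1342 u → a ∷ b ∷ c ∷ d ∷ [] ⊆ u → b < c → d ≤ b → d ≤ a
    go {u = _ ∷ _} (_ , v) (_ ∷ʳ p) = go v p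
    go {u = _ ∷ _} (q , _) (refl ∷ p) = go′ q p

  No12Below-≤ : x ≤ y → No12Below y u → No12Below x u
  No12Below-≤ p = AllPairs.map λ f q → f (ℕ.≤-trans q p)

  M≤top : ∀ M e → M ≤ suc (M + e)
  M≤top M e = ℕ.m≤n⇒m≤1+n (ℕ.m≤m+n M e)

  -- The bound is the largest entry pushed so far: whatever is still to come below it waits on the
  -- stack and leaves in decreasing order. `No12Below-≤` then lowers the bound to the entry just
  -- output.
  wordD-12 : ∀ M (w : D h k) → popsD w ≤ M → No12Below M (wordD M w)
  wordE-12 : ∀ M N (w : E h k) → popsE w ≤ M → M ≤ N → No12Below N (wordE M N w)
  wordD-12 M stop p = []
  wordD-12 M (pop w) p =
    All.map (λ { (inj₁ q) _ → s≤s q ; (inj₂ q) r → ⊥-elim (ℕ.<⇒≱ q r) }) (wordD-bounds M w) ∷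
    wordD-12 M w (ℕ.<⇒≤ p)
  wordD-12 M (up w) p =
    All.universal (λ c q → s≤s (ℕ.≤-trans q (ℕ.m≤m+n M _))) _ ∷
    No12Below-≤ (M≤top M _) (wordE-12 M _ w p (M≤top M _))
  wordE-12 M N (push w) p r =
    All.map (λ { (inj₁ (_ , q)) _ → s≤s q
               ; (inj₂ (inj₁ q)) _ → s≤s (ℕ.≤-trans q (ℕ.≤-trans p (ℕ.m≤m+n M _)))
               ; (inj₂ (inj₂ q)) r → ⊥-elim (ℕ.<⇒≱ q r) }) (wordE-bounds M N w) ∷
    wordE-12 M N w p r
  wordE-12 M N (peak w) p r = wordD-12 N w (ℕ.≤-trans p r)

  wordD-no312 : ∀ M (w : D h k) → popsD w ≤ M → No312 (wordD M w)
  wordE-no312 : ∀ M N (w : E h k) → popsE w ≤ M → M + pushes w ≤ N → No312 (wordE M N w)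
  wordD-no312 M stop p = tt
  wordD-no312 M (pop w) p = No12Below-≤ p (wordD-12 M w (ℕ.<⇒≤ p)) , wordD-no312 M w (ℕ.<⇒≤ p)
  wordD-no312 M (up w) p = wordE-12 M _ w p (M≤top M _) , wordE-no312 M _ w p (ℕ.n≤1+n _)
  wordE-no312 M N (push w) p q =
    No12Below-≤ q′ (wordE-12 M N w p (ℕ.≤-trans (M≤top M _) q′)) , wordE-no312 M N w p (ℕ.<⇒≤ q′)
    where q′ = subst (_≤ N) (ℕ.+-suc M _) q
  wordE-no312 M N (peak w) p q = wordD-no312 N w (ℕ.≤-trans p (ℕ.≤-trans (ℕ.m≤m+n M 0) q))

  No231Above-lower : All (λ d → d ≤ y → d ≤ x) u → No231Above y u → No231Above x u
  No231Above-lower [] _ = tt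
  No231Above-lower (_ ∷ f) (p , q) = pairs f p , No231Above-lower f q
    where
    pairs : ∀ {u b} → All (λ d → d ≤ y → d ≤ x) u →
      AllPairs (λ c d → b < c → d ≤ b → d ≤ y) u → AllPairs (λ c d → b < c → d ≤ b → d ≤ x) u
    pairs [] [] = []
    pairs (_ ∷ f) (r ∷ rs) = All.zipWith (λ (g , h) s t → g (h s t)) (f , r) ∷ pairs f rs

  -- An entry above `b` appears only after the next push; by then everything still waiting below `b`
  -- is of the first batch, hence at most `M`.
  wordE-231 : ∀ M N (w : E h k) → popsE w ≤ M → M + pushes w < b → b ≤ N →
    AllPairs (λ c d → b < c → d ≤ b → d ≤ M) (wordE M N w)
  wordE-231 {b = b} M N (push w) p q r =
    All.universal (λ _ s → ⊥-elim (ℕ.<-asym s q′)) _ ∷ wordE-231 M N w p (ℕ.<⇒≤ q′) r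
    where q′ = subst (_< b) (ℕ.+-suc M _) q
  wordE-231 M N (peak w) p q r = allPairs-second
    (All.map (λ { (inj₁ s) _ _ _ → ℕ.≤-trans s p
                ; (inj₂ s) _ _ t → ⊥-elim (ℕ.<⇒≱ s (ℕ.≤-trans t r)) }) (wordD-bounds N w))

  wordD-no231 : ∀ M (w : D h k) → popsD w ≤ M → No231Above M (wordD M w)
  wordE-no231 : ∀ M N (w : E h k) → popsE w ≤ M → M + pushes w ≤ N → No231Above M (wordE M N w)
  wordD-no231 M stop p = tt
  wordD-no231 M (pop w) p =
    allPairs (λ _ _ _ q → ℕ.≤-trans q p) _ , wordD-no231 M w (ℕ.<⇒≤ p)
  wordD-no231 M (up w) p =
    wordE-231 M _ w p ℕ.≤-refl ℕ.≤-refl , wordE-no231 M _ w p (ℕ.n≤1+n _)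
  wordE-no231 M N (push w) p q = wordE-231 M N w p ℕ.≤-refl q′ , wordE-no231 M N w p (ℕ.<⇒≤ q′)
    where q′ = subst (_≤ N) (ℕ.+-suc M _) q
  wordE-no231 M N (peak w) p q = No231Above-lower
    (All.map (λ { (inj₁ s) _ → ℕ.≤-trans s p ; (inj₂ s) t → ⊥-elim (ℕ.<⇒≱ s t) }) (wordD-bounds N w))
    (wordD-no231 N w (ℕ.≤-trans p (ℕ.≤-trans (ℕ.m≤m+n M 0) q)))

  No231Above-≤ : x ≤ y → No231Above x u → No231Above y u
  No231Above-≤ p = No231Above-lower (All.universal (λ _ q → ℕ.≤-trans q p) _)

  wordD-no1342 : ∀ M (w : D h k) → popsD w ≤ M → No1342 (wordD M w)
  wordE-no1342 : ∀ M N (w : E h k) → popsE w ≤ M → M + pushes w ≤ N → No1342 (wordE M N w)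
  wordD-no1342 M stop p = tt
  -- The bound drops from `M` to the popped entry, as no entry between the two is still to come.
  wordD-no1342 M (pop w) p =
    No231Above-lower (All.map (λ { (inj₁ s) _ → ℕ.m≤n⇒m≤1+n s ; (inj₂ s) t → ⊥-elim (ℕ.<⇒≱ s t) }) (wordD-bounds M w))
      (wordD-no231 M w (ℕ.<⇒≤ p)) ,
    wordD-no1342 M w (ℕ.<⇒≤ p)
  wordD-no1342 M (up w) p =
    No231Above-≤ (M≤top M _) (wordE-no231 M _ w p (ℕ.n≤1+n _)) , wordE-no1342 M _ w p (ℕ.n≤1+n _)
  wordE-no1342 M N (push w) p q =
    No231Above-≤ (M≤top M _) (wordE-no231 M N w p (ℕ.<⇒≤ q′)) , wordE-no1342 M N w p (ℕ.<⇒≤ q′)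
    where q′ = subst (_≤ N) (ℕ.+-suc M _) q
  wordE-no1342 M N (peak w) p q = wordD-no1342 N w (ℕ.≤-trans p (ℕ.≤-trans (ℕ.m≤m+n M 0) q))

  toU : D 0 k → U312-1342 (suc (2 * k))
  toU w = toWord w , toWord-perm w , toWord-uniquelySorted w ,
    No312⇒avoids (wordD-12 top w (ℕ.n≤1+n _) , wordD-no312 top w (ℕ.n≤1+n _)) ,
    No1342⇒avoids (wordD-no231 top w (ℕ.n≤1+n _) , wordD-no1342 top w (ℕ.n≤1+n _))
    where top = suc (popsD w)

  -- Reading words back

  -- The head tells `pop`, with output at most `M`, from `up`, with output above `M`. The output of
  -- `up` also fixes the number of pushes, which tells `push` from `peak`.
  wordD-injective : ∀ M (w w′ : D h k) → popsD w ≤ M → popsD w′ ≤ M → wordD M w ≡ wordD M w′ → w ≡ w′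
  wordE-injective : ∀ M N (w w′ : E h k) → popsE w ≤ N → popsE w′ ≤ N → pushes w ≡ pushes w′ →
    wordE M N w ≡ wordE M N w′ → w ≡ w′
  wordD-injective M stop stop _ _ _ = refl
  wordD-injective M (pop w) (pop w′) p q e =
    cong pop (wordD-injective M w w′ (ℕ.<⇒≤ p) (ℕ.<⇒≤ q) (List.∷-injectiveʳ e))
  wordD-injective M (pop w) (up w′) p q e =
    ⊥-elim (ℕ.<⇒≱ (ℕ.≤-trans p (ℕ.m≤m+n M _)) (ℕ.≤-reflexive (sym (ℕ.suc-injective (List.∷-injectiveˡ e)))))
  wordD-injective M (up w) (pop w′) p q e =
    ⊥-elim (ℕ.<⇒≱ (ℕ.≤-trans q (ℕ.m≤m+n M _)) (ℕ.≤-reflexive (ℕ.suc-injective (List.∷-injectiveˡ e))))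
  wordD-injective M (up w) (up w′) p q e = cong up
    (wordE-injective M _ w w′ (ℕ.≤-trans p (M≤top M _)) (ℕ.≤-trans q (M≤top M _)) same
      (trans (List.∷-injectiveʳ e) (cong (λ i → wordE M (suc (M + i)) w′) (sym same))))
    where
    same : pushes w ≡ pushes w′
    same = ℕ.+-cancelˡ-≡ M _ _ (ℕ.suc-injective (List.∷-injectiveˡ e))
  wordE-injective M N (push w) (push w′) p q r e =
    cong push (wordE-injective M N w w′ p q (ℕ.suc-injective r) (List.∷-injectiveʳ e))
  wordE-injective M N (peak w) (peak w′) p q r e = cong peak (wordD-injective N w w′ p q e)

  toWord-injective : (w w′ : D 0 k) → toWord w ≡ toWord w′ → w ≡ w′
  toWord-injective w w′ e = wordD-injective _ w w′ (ℕ.n≤1+n _)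
    (ℕ.m≤n⇒m≤1+n (ℕ.≤-reflexive (sym same)))
    (trans (List.∷-injectiveʳ e) (cong (λ i → wordD (suc i) w′) (sym same)))
    where
    same : popsD w ≡ popsD w′
    same = ℕ.suc-injective (List.∷-injectiveˡ e)

  Enumerates : List ℕ → (ℕ → Set) → Set
  Enumerates u P = Unique u × (∀ {z} → z ∈ u → P z) × (∀ {z} → P z → z ∈ u)

  enumerates-tail : {P Q : ℕ → Set} → Enumerates (x ∷ u) P →
    (∀ {z} → P z → z ≢ x → Q z) → (∀ {z} → Q z → P z × z ≢ x) → Enumerates u Q
  enumerates-tail {x} {u} {P} {Q} (p ∷ U , to , from) f g =
    U , (λ i → f (to (there i)) λ { refl → All.lookup p i refl }) , λ q → go (from (proj₁ (g q))) (proj₂ (g q))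
    where
    go : z ∈ x ∷ u → z ≢ x → z ∈ u
    go (here e) n = ⊥-elim (n e)
    go (there i) _ = i

  less : a < b → c < d → (a < b → c < d) × (c < d → a < b)
  less p q = (λ _ → q) , (λ _ → p)

  greater : b < a → d < c → (a < b → c < d) × (c < d → a < b)
  greater p q = (λ r → ⊥-elim (ℕ.<-asym p r)) , (λ r → ⊥-elim (ℕ.<-asym q r))

  order312 : b < c → c < a → SameOrder (a ∷ b ∷ c ∷ []) p312
  order312 p q =
    (greater (ℕ.<-trans p q) (s<s z<s) ∷ greater q (s<s (s<s z<s)) ∷ []) ∷
    (less p (s<s z<s) ∷ []) ∷ [] ∷ []

  order1342 : a < d → d < b → b < c → SameOrder (a ∷ b ∷ c ∷ d ∷ []) p1342
  order1342 p q r =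
    (less (ℕ.<-trans p q) (s<s z<s) ∷ less (ℕ.<-trans p (ℕ.<-trans q r)) (s<s z<s) ∷ less p (s<s z<s) ∷ []) ∷
    (less r (s<s (s<s (s<s z<s))) ∷ greater q (s<s (s<s z<s)) ∷ []) ∷
    (greater (ℕ.<-trans q r) (s<s (s<s z<s)) ∷ []) ∷ [] ∷ []

  avoids-⊆ : ∀ {τ} → u ⊆ v → Avoids τ v → Avoids τ u
  avoids-⊆ p av (σ , q , o) = av (σ , ⊆-trans q p , o)

  InD : ℕ → ℕ → ℕ → ℕ → Set
  InD n r M z = (0 < z × z ≤ r) ⊎ (M < z × z ≤ n)

  InE : ℕ → ℕ → ℕ → ℕ → ℕ → ℕ → Set
  InE n r M j N z = (M < z × z ≤ M + j) ⊎ InD n r N z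

  -- The next entry is a new maximum or the top of the stack, else the top would
  -- complete a 312 with the previous entry p.  If the top was pushed after the
  -- first entry f, a new maximum is impossible too, as the top would complete a
  -- 1342 with f, p and that maximum.
  parseD : ∀ r M u → r < p → p ≤ M → f ≤ M → Enumerates u (InD n r M) →
    Avoids p312 (p ∷ u) → Avoids p1342 (f ∷ u) → Sorted (p ∷ u) →
    des p u ≡ k → length u ≡ h + (k + k) →
    Σ (D h k) λ w → wordD M w ≡ u × popsD w ≡ r
  parseE : ∀ r M N j u → p ≡ suc (M + j) → r ≤ M → p ≤ N → f ≤ M → M + j ≤ n → Enumerates u (InE n r M j N) →
    Avoids p312 (p ∷ u) → Avoids p1342 (f ∷ p ∷ u) → Sorted (p ∷ u) →
    des p u ≡ k → length u ≡ h + (k + k) →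
    Σ (E h k) λ w → wordE M N w ≡ u × pushes w ≡ j × popsE w ≡ r

  parseD {h = zero} zero M [] _ _ _ _ _ _ _ refl _ = stop , refl , refl
  parseD (suc r) M [] _ _ _ (_ , _ , from) _ _ _ _ _ with from (inj₁ (s≤s z≤n , ℕ.≤-refl))
  ... | ()
  parseD {p} {f} {n} {k} {h} r M (x ∷ u) r<p p≤M f≤M en@(_ , to , from) av av′ S d l with to (here refl)
  ... | inj₁ (0<x , x≤r) = popCase r x 0<x x≤r r<p en S d l (ℕ.m≤n⇒m<n∨m≡n x≤r) av av′
    where
    popCase : ∀ r x → 0 < x → x ≤ r → r < p → Enumerates (x ∷ u) (InD n r M) → Sorted (p ∷ x ∷ u) →
      des p (x ∷ u) ≡ k → length (x ∷ u) ≡ h + (k + k) → x < r ⊎ x ≡ r →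
      Avoids p312 (p ∷ x ∷ u) → Avoids p1342 (f ∷ x ∷ u) →
      Σ (D h k) λ w → wordD M w ≡ x ∷ u × popsD w ≡ r
    popCase r x 0<x x≤r r<p (_ , _ , from) S d l (inj₁ x<r) av av′ with from (inj₁ (ℕ.<-trans 0<x x<r , ℕ.≤-refl))
    ... | here refl = ⊥-elim (ℕ.<-irrefl refl x<r)
    ... | there i = ⊥-elim (av (p ∷ x ∷ r ∷ [] , refl ∷ refl ∷ from∈ i , order312 x<r r<p))
    popCase (suc r) _ 0<x x≤r r<p en S d l (inj₂ refl) av av′ with trans (cong (_+ des (suc r) u) (sym (fall-yes r<p))) d
    ... | refl with parseD r M u ℕ.≤-refl (ℕ.≤-trans (ℕ.<⇒≤ r<p) p≤M) f≤M
          (enumerates-tail en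
            (λ { (inj₁ (a , b)) ne → inj₁ (a , ℕ.≤-pred (ℕ.≤∧≢⇒< b ne)) ; (inj₂ q) _ → inj₂ q })
            (λ { (inj₁ (a , b)) → inj₁ (a , ℕ.m≤n⇒m≤1+n b) , λ { refl → ℕ.<-irrefl refl b }
               ; (inj₂ (a , b)) → inj₂ (a , b) , λ { refl → ℕ.<⇒≱ a (ℕ.≤-trans (ℕ.<⇒≤ r<p) p≤M) } }))
          (avoids-⊆ (p ∷ʳ ⊆-refl) av) (avoids-⊆ (refl ∷ (_ ∷ʳ ⊆-refl)) av′) (tail-sorted S) refl
          (ℕ.suc-injective (trans l (trans (cong (λ i → h + suc i) (ℕ.+-suc _ _)) (trans (ℕ.+-suc h _) (cong suc (ℕ.+-suc h _))))))
    ... | w , e , q = pop w , cong₂ _∷_ (cong suc q) e , cong suc q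
  ... | inj₂ (M<x , x≤n) = upCase (ℕ.m≤n⇒∃[o]m+o≡n M<x) h l
    where
    k≡ : des x u ≡ k
    k≡ = trans (cong (_+ des x u) (sym (fall-no (ℕ.<⇒≤ (ℕ.≤-<-trans p≤M M<x))))) d
    -- The excess of the new maximum over `M` reveals the number `j` of entries pushed below it.
    upCase : (∃[ j ] suc M + j ≡ x) → ∀ h → suc (length u) ≡ h + (k + k) →
      Σ (D h k) λ w → wordD M w ≡ x ∷ u × popsD w ≡ r
    -- An ascent at `h = 0` would leave a sorted suffix `x ∷ u` with `k` descents and `u` of length
    -- `2k − 1`, against `des-bound`.
    upCase _ zero l = ⊥-elim (ℕ.<⇒≱ (ℕ.≤-reflexive l) (subst (λ k → k + k ≤ length u) k≡ (des-bound (tail-sorted S))))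
    upCase (j , refl) (suc h) l with parseE r M (suc (M + j)) j u refl (ℕ.<⇒≤ (ℕ.<-≤-trans r<p p≤M)) ℕ.≤-refl f≤M (ℕ.<⇒≤ x≤n)
          (enumerates-tail en
            (λ { (inj₁ q) _ → inj₂ (inj₁ q)
               ; {z} (inj₂ (a , b)) ne → [ (λ z≤ → inj₁ (a , z≤)) , (λ z> → inj₂ (inj₂ (ℕ.≤∧≢⇒< z> (λ e → ne (sym e)) , b))) ]′ (ℕ.≤-<-connex z (M + j)) })
            (λ { (inj₁ (a , b)) → inj₂ (a , ℕ.≤-trans b (ℕ.<⇒≤ x≤n)) , λ { refl → ℕ.<-irrefl refl b }
               ; (inj₂ (inj₁ (a , b))) → inj₁ (a , b) , λ { refl → ℕ.<⇒≱ (ℕ.<-trans (ℕ.<-≤-trans r<p p≤M) M<x) b }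
               ; (inj₂ (inj₂ (a , b))) → inj₂ (ℕ.<-trans M<x a , b) , λ { refl → ℕ.<-irrefl refl a } }))
          (avoids-⊆ (p ∷ʳ ⊆-refl) av) av′ (tail-sorted S) k≡ (ℕ.suc-injective l)
    ... | w , e , q , q′ = up w , trans (cong (λ i → suc (M + i) ∷ wordE M (suc (M + i)) w) q) (cong (_ ∷_) e) , q′

  parseE {p} r M N zero u refl r≤M p≤N f≤M _ (U , to , from) av av′ S d l
    with parseD r N u (s≤s (ℕ.≤-trans r≤M (ℕ.m≤m+n M 0))) p≤N
      (ℕ.≤-trans f≤M (ℕ.≤-trans (M≤top M 0) p≤N))
      (U , (λ i → [ (λ (a , b) → ⊥-elim (ℕ.<⇒≱ a (subst (_ ≤_) (ℕ.+-identityʳ M) b))) , (λ q → q) ]′ (to i)) , (λ q → from (inj₂ q)))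
      av (avoids-⊆ (refl ∷ (_ ∷ʳ ⊆-refl)) av′) S d l
  ... | w , e , q = peak w , e , refl , q
  parseE r M N (suc j) [] _ _ _ _ _ (_ , _ , from) _ _ _ _ _ with from (inj₁ (ℕ.m<m+n M (s≤s z≤n) , ℕ.≤-refl))
  ... | ()
  parseE {p} {f} {n} {k} {h} r M N (suc j) (y ∷ u) refl r≤M p≤N f≤M j≤n en@(_ , to , from) av av′ S d l
    with from (inj₁ (ℕ.m<m+n M (s≤s z≤n) , ℕ.≤-refl)) | to (here refl)
  ... | there i | inj₁ (_ , b) = ⊥-elim (av (_ , refl ∷ refl ∷ from∈ i , order312 (ℕ.≤∧≢⇒< b ne) ℕ.≤-refl))
    where
    ne : y ≢ M + suc j
    ne refl = All.lookup (AllPairs.head (proj₁ en)) i refl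
  ... | there i | inj₂ (inj₁ (_ , b)) = ⊥-elim (av (_ , refl ∷ refl ∷ from∈ i ,
    order312 (ℕ.≤-<-trans (ℕ.≤-trans b r≤M) (ℕ.m<m+n M (s≤s z≤n))) ℕ.≤-refl))
  ... | there i | inj₂ (inj₂ (a , _)) = ⊥-elim (av′ (_ , refl ∷ refl ∷ refl ∷ from∈ i ,
    order1342 (ℕ.≤-<-trans f≤M (ℕ.m<m+n M (s≤s z≤n))) ℕ.≤-refl (ℕ.≤-<-trans p≤N a)))
  ... | here refl | _ with trans (cong (_+ des (M + suc j) u) (sym (fall-yes {M + suc j} {suc (M + suc j)} ℕ.≤-refl))) d
  ... | refl with parseE r M N j u (ℕ.+-suc M j) r≤M (ℕ.<⇒≤ p≤N) f≤M (ℕ.≤-trans (ℕ.+-monoʳ-≤ M (ℕ.n≤1+n j)) j≤n)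
        (enumerates-tail en
          (λ { {z} (inj₁ (a , b)) ne → inj₁ (a , ℕ.≤-pred (subst (z <_) (ℕ.+-suc M j) (ℕ.≤∧≢⇒< b ne))) ; (inj₂ q) _ → inj₂ q })
          (λ { (inj₁ (a , b)) → inj₁ (a , ℕ.≤-trans b (ℕ.+-monoʳ-≤ M (ℕ.n≤1+n j))) , λ { refl → ℕ.<⇒≱ (ℕ.+-monoʳ-< M ℕ.≤-refl) b }
             ; (inj₂ (inj₁ (a , b))) → inj₂ (inj₁ (a , b)) , λ { refl → ℕ.<⇒≱ (ℕ.m<m+n M (s≤s z≤n)) (ℕ.≤-trans b r≤M) }
             ; (inj₂ (inj₂ (a , b))) → inj₂ (inj₂ (a , b)) , λ { refl → ℕ.<⇒≱ a (ℕ.<⇒≤ p≤N) } }))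
        (avoids-⊆ (_ ∷ʳ ⊆-refl) av) (avoids-⊆ (refl ∷ (_ ∷ʳ ⊆-refl)) av′) (tail-sorted S) refl
        (ℕ.suc-injective (trans l (trans (cong (λ i → h + suc i) (ℕ.+-suc _ _)) (trans (ℕ.+-suc h _) (cong suc (ℕ.+-suc h _))))))
  ... | w , e , q , q′ = push w , cong₂ _∷_ (trans (cong (λ i → suc (M + i)) q) (sym (ℕ.+-suc M j))) e , cong suc q , q′

  perm-enumerates : ∀ {π} → IsPerm n π → Enumerates π (λ z → 0 < z × z ≤ n)
  perm-enumerates {n} perm =
    Unique-resp (↭-sym perm) (Unique.applyUpTo⁺₁ suc n (λ i<j _ e → ℕ.<-irrefl (ℕ.suc-injective e) i<j)) ,
    (λ i → let j , j<n , e = Mem.∈-applyUpTo⁻ suc (Perm.∈-resp-↭ perm i) in subst (λ z → 0 < z × z ≤ n) (sym e) (z<s , j<n)) ,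
    λ { (s≤s _ , p) → Perm.∈-resp-↭ (↭-sym perm) (Mem.∈-applyUpTo⁺ suc p) }

  uniquelySorted-exact : ∀ {π} → IsPerm (suc n) π → UniquelySorted (suc n) π → Sorted π × Exact π
  uniquelySorted-exact perm (σ , permσ , refl , unique) = s-sorted σ ,
    unique-preimage⇒exact σ (proj₁ (perm-enumerates permσ))
      (λ { refl → Perm.¬x∷xs↭[] (↭-sym permσ) })
      (λ τ e → unique τ (↭-trans (↭-sym (s-↭ τ)) (↭-trans (↭-reflexive e) perm)) e)

  toWord-surjective : ∀ {π} → IsPerm (suc (2 * k)) π → Sorted π → Exact π → Avoids p312 π → Avoids p1342 π →
    Σ (D 0 k) λ w → toWord w ≡ π
  toWord-surjective {k} {zero ∷ u} perm S x av av′ with proj₁ (proj₂ (perm-enumerates perm)) (here refl)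
  ... | () , _
  toWord-surjective {k} {suc r ∷ u} perm S x av av′
    -- At the start `suc r` is at once the first entry, the previous entry and the largest entry
    -- pushed; `1, …, r` wait on the stack.
    with parseD r (suc r) u ℕ.≤-refl ℕ.≤-refl ℕ.≤-refl
      (enumerates-tail en
        (λ {z} (a , b) ne → [ (λ z≤ → inj₁ (a , z≤)) , (λ z> → inj₂ (ℕ.≤∧≢⇒< z> (λ e → ne (sym e)) , b)) ]′
          (ℕ.≤-<-connex z r))
        (λ { (inj₁ (a , b)) → (a , ℕ.≤-trans b (ℕ.<⇒≤ r<n)) , λ { refl → ℕ.<-irrefl refl b }
           ; (inj₂ (a , b)) → (ℕ.<-trans z<s a , b) , λ { refl → ℕ.<-irrefl refl a } }))
      av av′ S des≡ (trans size (cong (k +_) (ℕ.+-identityʳ k)))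
    where
    en = perm-enumerates perm
    r<n = proj₂ (proj₁ (proj₂ en) (here refl))
    size : length u ≡ 2 * k
    size = ℕ.suc-injective (trans (Perm.↭-length perm) (List.length-applyUpTo suc (suc (2 * k))))
    des≡ : des (suc r) u ≡ k
    des≡ = ℕ.*-cancelˡ-≡ (des (suc r) u) k 2 (trans (cong (des (suc r) u +_) (ℕ.+-identityʳ _))
      (trans (ℕ.≤-antisym (des-bound S) x) size))
  ... | w , e , q = w , trans (cong (λ i → suc i ∷ wordD (suc i) w) q) (cong (_ ∷_) e)

-- Assembling the bijection.

open NoncrossingIntervals using (Code; []; _≈ᴵ_; interval; interval-injective; interval-surjective)
open Paths
open Permutations using (toWord; toWord-injective; toWord-surjective; toU; uniquelySorted-exact)

module _ (k : ℕ) where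
  parse : (π : U312-1342 (suc (2 * k))) → Σ (D 0 k) λ w → toWord w ≡ proj₁ π
  parse (π , perm , us , av , av′) =
    let S , x = uniquelySorted-exact perm us in toWord-surjective perm S x av av′

  code : D 0 k → ∃ (Code (0 ⊞ k))
  code w = toCode [] ≤′-refl (fromD w)

  -- Both sides are compared through `D 0 k`. The index `0 ⊞ k` is the one at which `toCode`
  -- arrives.
  bijection : Bijection (U312-1342-Setoid (suc (2 * k))) (IntNC-Setoid (0 ⊞ k))
  bijection = record
    { to = λ π → decode (proj₁ (parse π))
    -- `parse` works on the proofs inside `π` and `π′`, which may differ; injectivity of `toWord`
    -- makes its result depend on the word alone.
    ; cong = λ {π} {π′} e → subst (λ w → decode (proj₁ (parse π)) ≈ᴵ decode w)
        (toWord-injective _ _ (trans (proj₂ (parse π)) (trans e (sym (proj₂ (parse π′))))))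
        (≈ᴵ-refl {decode (proj₁ (parse π))})
    ; bijective =
        (λ {π} {π′} e → trans (sym (proj₂ (parse π))) (trans
          (cong toWord (decode-injective _ _ e)) (proj₂ (parse π′)))) ,
        λ I → let w , e = decode-surjective I in toU w , λ {π} f →
          subst (λ w → decode w ≈ᴵ I) (toWord-injective w _ (trans (sym f) (sym (proj₂ (parse π))))) e }
    where
    decode : D 0 k → IntNC (0 ⊞ k)
    decode w = interval (proj₂ (code w))
    decode-injective : ∀ w w′ → decode w ≈ᴵ decode w′ → w ≡ w′
    decode-injective w w′ e = trans (sym (toD-fromD w)) (trans
      (cong (toD 0) (toCode-injective _ _ (interval-injective (proj₂ (code w)) (proj₂ (code w′)) e))) (toD-fromD w′))
    decode-surjective : ∀ I → Σ (D 0 k) λ w → decode w ≈ᴵ I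
    decode-surjective I with interval-surjective I
    ... | ℓ , c , e with toCode-surjective (ℓ , c)
    ... | w , f = toD 0 w , subst (λ c → interval (proj₂ c) ≈ᴵ I)
      (sym (trans (cong (toCode [] ≤′-refl) (fromD-toD 0 w)) f)) e
    ≈ᴵ-refl : ∀ {I : IntNC (0 ⊞ k)} → I ≈ᴵ I
    ≈ᴵ-refl = (λ _ _ → refl) , (λ _ _ → refl)

theorem7p1 : (k : ℕ) → Bijection (U312-1342-Setoid (suc (2 * k))) (IntNC-Setoid k)
theorem7p1 k = subst (λ n → Bijection (U312-1342-Setoid (suc (2 * k))) (IntNC-Setoid n)) (0⊞ k) (bijection k)
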